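{- For every constant $0<d\leq 1$ there is $\epsilon_0>0$ such that for every constant $0<\epsilon<\epsilon_0$ and every sufficiently large $n$ the following holds. Let $G$ be a $(d,\epsilon)$-regular graph on $n$ vertices and let $c_d=8/d$. Then for every subgraph $H$ of $G$ with maximum degree $\Delta(H)\leq (d/2-c_d\epsilon)n$, the graph $G-H$ contains a Hamilton cycle.
   Context: A graph $G=(V,E)$ on $n$ vertices is $(d,\epsilon)$-regular if its minimum degree is at least $dn$ and for every pair of disjoint subsets $S,T\subset V$ with $|S|,|T|\geq \epsilon n$, the number $e(S,T)$ of edges between $S$ and $T$ satisfies $\left|\frac{e(S,T)}{|S||T|}-d\right|\leq\epsilon$. $G-H$ denotes the graph on $V(G)$ with edge set $E(G)\setminus E(H)$. (The paper's hypothesis reads "$0<\epsilon\ll d\leq 1$ are constants", i.e., $\epsilon$ sufficiently small relative to $d$.)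
   Formalization: The constants d and ε (and the threshold ε₀) range over the rational numbers instead of the real numbers. -}

module Defs where

open import Data.Bool using (Bool; true; false; _∧_; not; if_then_else_)
open import Data.Nat as ℕ using (ℕ; zero; suc)
open import Data.Nat.DivMod using (_%_; m%n<n)
open import Data.Fin using (Fin; toℕ; fromℕ<)
open import Data.Fin.Subset using (Subset; ∣_∣; _∈_)
open import Data.Fin.Permutation using (Permutation′; _⟨$⟩ʳ_)
open import Data.List using (List; map; allFin)
open import Data.Nat.ListAction using (sum)
open import Data.Vec using (lookup)
open import Data.Product using (Σ; _×_)
open import Data.Integer using (+_)
open import Data.Rational using (ℚ; _/_; _+_; _-_; _*_; _÷_; _≤_; _>_; 0ℚ; positive) renaming (∣_∣ to abs)
open import Data.Rational.Properties using (pos⇒nonZero)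
open import Relation.Nullary using (¬_)
open import Relation.Binary.PropositionalEquality using (_≡_)

ℕ→ℚ : ℕ → ℚ
ℕ→ℚ n = + n / 1

record Graph (n : ℕ) : Set where
  field
    adj    : Fin n → Fin n → Bool
    sym    : ∀ u v → adj u v ≡ adj v u
    irrefl : ∀ v → adj v v ≡ false
open Graph public

count : ∀ {n} → (Fin n → Bool) → ℕ
count {n} f = sum (map (λ i → if f i then 1 else 0) (allFin n))

degree : ∀ {n} → Graph n → Fin n → ℕ
degree G v = count (adj G v)

-- e(S,T): number of (ordered) pairs (u,v), u ∈ S, v ∈ T, uv an edge.
-- For disjoint S, T this is the number of edges between S and T.
eST : ∀ {n} → Graph n → Subset n → Subset n → ℕ
eST {n} G S T = sum (map (λ u → count (λ v → lookup S u ∧ (lookup T v ∧ adj G u v))) (allFin n))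

Disjoint : ∀ {n} → Subset n → Subset n → Set
Disjoint S T = ∀ v → ¬ (v ∈ S × v ∈ T)

-- (d,ε)-regular graph on n vertices.
-- The condition |e(S,T)/(|S||T|) - d| ≤ ε is written with the denominator
-- |S||T| (>0) cleared: |e(S,T) - d|S||T|| ≤ ε|S||T|.
Regular : ∀ {n} → ℚ → ℚ → Graph n → Set
Regular {n} d ε G =
  (∀ v → d * ℕ→ℚ n ≤ ℕ→ℚ (degree G v)) ×
  (∀ (S T : Subset n) → Disjoint S T →
     ε * ℕ→ℚ n ≤ ℕ→ℚ ∣ S ∣ → ε * ℕ→ℚ n ≤ ℕ→ℚ ∣ T ∣ →
     abs (ℕ→ℚ (eST G S T) - d * ℕ→ℚ (∣ S ∣ ℕ.* ∣ T ∣)) ≤ ε * ℕ→ℚ (∣ S ∣ ℕ.* ∣ T ∣))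

_⊑_ : ∀ {n} → Graph n → Graph n → Set
H ⊑ G = ∀ u v → adj H u v ≡ true → adj G u v ≡ true

MaxDegree≤ : ∀ {n} → Graph n → ℚ → Set
MaxDegree≤ H x = ∀ v → ℕ→ℚ (degree H v) ≤ x

_⊖_ : ∀ {n} → Graph n → Graph n → Graph n
adj (G ⊖ H) u v = adj G u v ∧ not (adj H u v)
sym (G ⊖ H) u v rewrite sym G u v | sym H u v = Relation.Binary.PropositionalEquality.refl
irrefl (G ⊖ H) v rewrite irrefl G v = Relation.Binary.PropositionalEquality.refl

next : ∀ {n} → Fin n → Fin n
next {suc m} i = fromℕ< (m%n<n (suc (toℕ i)) (suc m))

-- Hamilton cycle: a cyclic ordering σ(0),σ(1),…,σ(n-1) of all vertices with
-- σ(i)σ(i+1 mod n) an edge for all i (n ≥ 3 in the theorem, as n is large)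
HamiltonCycle : ∀ {n} → Graph n → Set
HamiltonCycle {n} G = Σ (Permutation′ n) λ σ → ∀ i → adj G (σ ⟨$⟩ʳ i) (σ ⟨$⟩ʳ next i) ≡ true

c : (d : ℚ) → d > 0ℚ → ℚ
c d d>0 = _÷_ (+ 8 / 1) d {{pos⇒nonZero d {{positive d>0}}}}

{-# OPTIONS --safe #-}
module Submission where

-- Put Γ = G − H and list all vertices in some order p … q, counting the non-adjacent
-- consecutive pairs. Regularity makes Γ an expander: disjoint sets of at least s ≈ εn and
-- t ≈ (1/2 − 6ε/d)n vertices are joined by an edge. Since p and q have more than dn/2
-- neighbours, there are disjoint short windows I and J of the list in which p, respectively
-- q, has more than s neighbours. One rotation at each end turns the list into one that starts
-- at any chosen f from s predecessors of neighbours of p in I and ends at any chosen v from s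
-- shifted neighbours of q in J, and outside the two windows its consecutive pairs do not
-- depend on f and v. There are at least 2t such pairs (a , b); if no v were adjacent to an a
-- and, for the same pair, no f to the b, then one of the two sets would miss t vertices. So
-- v ~ a and f ~ b for some pair, and the usual Pósa exchange closes the list into a cyclic
-- order. No step creates a new defect, hence cutting the cyclic order at a defect lowers their
-- number, and a cyclic order without defects is a Hamilton cycle.
open import Defs
open import Data.Bool using (Bool; true; false; _∧_; not; if_then_else_)
import Data.Bool.Properties as Bool
open import Data.Fin as Fin using (Fin; zero; suc; toℕ)
open import Data.Fin.Permutation using (Permutation; Permutation′; _∘ₚ_; cast-id; _⟨$⟩ʳ_)
open import Data.Fin.Properties using (toℕ-cast; toℕ-fromℕ<; toℕ<n; cast-involutive)
open import Data.Fin.Subset using (Subset; ∣_∣; ⊥)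
open import Data.Fin.Subset.Properties using (∣⊥∣≡0)
open import Data.List as List using (List; []; _∷_; _++_; map; length; reverse; filter; take; drop; tabulate; allFin)
open import Data.List.Membership.Propositional using (_∈_; find; lose)
open import Data.List.Membership.Propositional.Properties using (∈-map⁻; ∈-filter⁻; ∈-++⁻; ∈-++⁺ʳ)
open import Data.List.Properties using (++-assoc; ++-identityʳ; ++-monoid; reverse-++; reverse-involutive; unfold-reverse; length-reverse; map-++; map-tabulate; length-map; length-++; length-take; length-drop; length-tabulate; take++drop≡id; lookup-tabulate)
open import Data.List.Relation.Binary.Permutation.Homogeneous using (onIndices)
open import Data.List.Relation.Binary.Permutation.Propositional using (_↭_; ↭-refl; ↭-sym; ↭-trans; ↭-reflexive; ↭⇒↭ₛ; module PermutationReasoning)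
open import Data.List.Relation.Binary.Permutation.Propositional.Properties using (↭-length; ↭-reverse; map⁺; ++-comm) renaming (++⁺ to ↭-++⁺; ++⁺ˡ to ↭-++⁺ˡ; ++-commutativeMonoid to ↭-++-commutativeMonoid)
import Data.List.Relation.Binary.Permutation.Setoid.Properties as ↭ₛ
open import Data.List.Relation.Binary.Sublist.Propositional using (_⊆_; []; _∷_; _∷ʳ_; ⊆-refl; ⊆-trans)
import Data.List.Relation.Binary.Sublist.Propositional.Properties as Sub
open import Data.List.Relation.Unary.All as All using (All; []; _∷_)
open import Data.List.Relation.Unary.AllPairs using ([]; _∷_)
open import Data.List.Relation.Unary.Any using (Any; here; there; any?)
open import Data.List.Relation.Unary.Unique.Propositional using (Unique)
open import Data.List.Relation.Unary.Unique.Propositional.Properties using (allFin⁺)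
open import Data.Nat as ℕ using (ℕ; zero; suc; z≤n; s≤s; _≥_)
open import Data.Nat.DivMod using (_%_; m%n<n; m<n⇒m%n≡m; n%n≡0)
open import Data.Nat.ListAction using (sum)
open import Data.Nat.ListAction.Properties using (sum-++; sum-↭)
import Data.Nat.Properties as ℕ
import Data.Nat.Solver as ℕ
open import Data.Product using (Σ; ∃; ∃₂; _×_; _,_; proj₁; proj₂)
open import Data.Sum using (_⊎_; inj₁; inj₂)
open import Data.Vec using ([]; _∷_; lookup; _[_]≔_)
open import Data.Vec.Properties using ([]=⇒lookup; lookup-replicate; lookup∘update′)
open import Function using (_∘_)
open import Relation.Binary.PropositionalEquality as ≡ using (_≡_; _≢_; refl; cong; cong₂; subst; setoid)
open import Relation.Nullary using (¬_; Dec; yes; no; does; contradiction)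
open import Relation.Nullary.Decidable using (¬?)
open import Relation.Unary using (Decidable)
import Algebra.Solver.CommutativeMonoid as CommutativeMonoidSolver
import Algebra.Solver.Monoid as MonoidSolver

module Combinatorics where

  open import Data.Nat using (_+_; _*_; _∸_; _≤_; _<_; _≤?_; >-nonZero)
  open import Data.Nat.Properties
  open import Data.Nat.Solver using (module +-*-Solver)

  -- Ends and consecutive pairs of lists

  module _ {A : Set} where

    data Starts (x : A) : List A → Set where
      starts : ∀ ys → Starts x (x ∷ ys)

    Ends : A → List A → Set
    Ends x xs = Starts x (reverse xs)

    starts-reverse : ∀ {x} xs → Starts x xs → Ends x (reverse xs)
    starts-reverse xs = subst (Starts _) (≡.sym (reverse-involutive xs))

    starts-++ : ∀ {x xs} ys → Starts x xs → Starts x (xs ++ ys)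
    starts-++ ys (starts zs) = starts (zs ++ ys)

    ends-++ : ∀ {x} xs {ys} → Ends x ys → Ends x (xs ++ ys)
    ends-++ xs {ys} e = subst (Starts _) (≡.sym (reverse-++ xs ys)) (starts-++ (reverse xs) e)

    -- The hypothesis `Ends y xs` serves as evidence that `xs` is non-empty, so that the first entry
    -- of the whole list lies in it.
    starts-++⁻ : ∀ {x y} xs {ys} → Ends y xs → Starts x (xs ++ ys) → Starts x xs
    starts-++⁻ (x ∷ xs) _ (starts _) = starts xs

    ends-++⁻ : ∀ {x y} xs {ys} → Starts y ys → Ends x (xs ++ ys) → Ends x ys
    ends-++⁻ xs {ys} s e = starts-++⁻ (reverse ys) (starts-reverse ys s)
      (subst (Starts _) (reverse-++ xs ys) e)

    ends⇒∷ʳ : ∀ {x} xs → Ends x xs → ∃ λ zs → xs ≡ zs ++ x ∷ []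
    ends⇒∷ʳ xs e with reverse xs in eq | e
    ... | _ ∷ zs | starts _ = reverse zs ,
      ≡.trans (≡.sym (reverse-involutive xs)) (≡.trans (cong reverse eq) (unfold-reverse _ zs))

    links : List A → List (A × A)
    links (x ∷ y ∷ zs) = (x , y) ∷ links (y ∷ zs)
    links _            = []

    -- Records a cut of the list between `a` and `b` rather than a position, because rotations and
    -- the final exchange reassemble the two pieces.
    Link : A → A → List A → Set
    Link a b xs = ∃₂ λ ys zs → xs ≡ ys ++ zs × Ends a ys × Starts b zs

    ∈-links⁻ : ∀ {a b} xs → (a , b) ∈ links xs → Link a b xs
    ∈-links⁻ (x ∷ y ∷ zs) (here refl) = x ∷ [] , y ∷ zs , refl , starts [] , starts zs
    ∈-links⁻ (x ∷ y ∷ zs) (there l) with ∈-links⁻ (y ∷ zs) l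
    ... | us , vs , eq , e , s = x ∷ us , vs , cong (x ∷_) eq , ends-++ (x ∷ []) {us} e , s

    link-++ˡ : ∀ {a b} xs {ys} → Link a b ys → Link a b (xs ++ ys)
    link-++ˡ xs (us , vs , refl , e , s) = xs ++ us , vs , ≡.sym (++-assoc xs us vs) , ends-++ xs {us} e , s

    link-++ʳ : ∀ {a b} xs {ys} → Link a b xs → Link a b (xs ++ ys)
    link-++ʳ xs {ys} (us , vs , refl , e , s) = us , vs ++ ys , ++-assoc us vs ys , e , starts-++ ys s

    -- As a sublist, and not merely a subset, the first entries of the links inherit `Unique` from
    -- the list.
    links₁-⊆ : ∀ xs → map proj₁ (links xs) ⊆ xs
    links₁-⊆ []           = []
    links₁-⊆ (x ∷ [])     = x ∷ʳ []
    links₁-⊆ (x ∷ y ∷ zs) = refl ∷ links₁-⊆ (y ∷ zs)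

    links₂-⊆ : ∀ xs → map proj₂ (links xs) ⊆ xs
    links₂-⊆ []       = []
    links₂-⊆ (x ∷ xs) = x ∷ʳ tail-⊆ x xs
      where
      tail-⊆ : ∀ x xs → map proj₂ (links (x ∷ xs)) ⊆ xs
      tail-⊆ x []       = []
      tail-⊆ x (y ∷ ys) = refl ∷ tail-⊆ y ys

    length-links : ∀ xs → length xs ≤ suc (length (links xs))
    length-links []           = z≤n
    length-links (x ∷ [])     = s≤s z≤n
    length-links (x ∷ y ∷ zs) = s≤s (length-links (y ∷ zs))

    unique-⊆ : ∀ {xs ys : List A} → xs ⊆ ys → Unique ys → Unique xs
    unique-⊆ []         _        = []
    unique-⊆ (y ∷ʳ p)   (_ ∷ u)  = unique-⊆ p u
    unique-⊆ (refl ∷ p) (px ∷ u) = Sub.All-resp-⊆ p px ∷ unique-⊆ p u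

    unique-↭ : ∀ {xs ys : List A} → xs ↭ ys → Unique xs → Unique ys
    unique-↭ p = ↭ₛ.Unique-resp-↭ (setoid A) (↭⇒↭ₛ p)

    module _ {P : A → Set} (P? : Decidable P) where

      length-filter-split : ∀ xs → length xs ≤ length (filter P? xs) + length (filter (¬? ∘ P?) xs)
      length-filter-split []       = z≤n
      length-filter-split (x ∷ xs) with does (P? x)
      ... | true  = s≤s (length-filter-split xs)
      ... | false = ≤-trans (s≤s (length-filter-split xs)) (≤-reflexive (≡.sym (+-suc _ _)))

    -- Counting along a list and dense windows

    cnt : (A → Bool) → List A → ℕ
    cnt p xs = sum (map (λ i → if p i then 1 else 0) xs)

    cnt-++ : ∀ p xs ys → cnt p (xs ++ ys) ≡ cnt p xs + cnt p ys
    cnt-++ p xs ys = ≡.trans (cong sum (map-++ _ xs ys)) (sum-++ (map _ xs) (map _ ys))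

    cnt-↭ : ∀ p {xs ys} → xs ↭ ys → cnt p xs ≡ cnt p ys
    cnt-↭ p r = sum-↭ (map⁺ _ r)

    if≤1 : ∀ b → (if b then 1 else 0) ≤ 1
    if≤1 true  = s≤s z≤n
    if≤1 false = z≤n

    cnt≤length : ∀ p xs → cnt p xs ≤ length xs
    cnt≤length p []       = z≤n
    cnt≤length p (x ∷ xs) = +-mono-≤ (if≤1 (p x)) (cnt≤length p xs)

    module _ (p : A → Bool) where

      heads tails : List A → List (A × A)
      heads xs = filter (λ l → p (proj₁ l) Bool.≟ true) (links xs)
      tails xs = filter (λ l → p (proj₂ l) Bool.≟ true) (links xs)

      -- Only the last entry of a list heads no link, hence the `suc`. In `cnt≤tails` it is the
      -- first entry that may be lost.
      cnt≤heads : ∀ xs → cnt p xs ≤ suc (length (heads xs))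
      cnt≤heads []       = z≤n
      cnt≤heads (x ∷ xs) = go x xs
        where
        go : ∀ x xs → cnt p (x ∷ xs) ≤ suc (length (heads (x ∷ xs)))
        go x []       = +-mono-≤ (if≤1 (p x)) z≤n
        go x (y ∷ ys) with p x
        ... | true  = s≤s (go y ys)
        ... | false = go y ys

      cnt≤tails : ∀ xs → cnt p xs ≤ suc (length (tails xs))
      cnt≤tails []       = z≤n
      cnt≤tails (x ∷ xs) = +-mono-≤ (if≤1 (p x)) (go x xs)
        where
        go : ∀ x xs → cnt p xs ≤ length (tails (x ∷ xs))
        go x []       = z≤n
        go x (y ∷ ys) with p y
        ... | true  = s≤s (go y ys)
        ... | false = go y ys

      -- Averaging over consecutive blocks of length ℓ.
      dense-window : ∀ r ℓ xs → 0 < ℓ → r * (length xs + ℓ) ≤ cnt p xs * ℓ →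
        ∃ λ as → ∃₂ λ ws bs → xs ≡ as ++ ws ++ bs × length ws ≤ ℓ × r ≤ cnt p ws
      dense-window r ℓ xs 0<ℓ = go (length xs) xs ≤-refl
        where
        instance _ = >-nonZero 0<ℓ
        Goal : List A → Set
        Goal xs = ∃ λ as → ∃₂ λ ws bs → xs ≡ as ++ ws ++ bs × length ws ≤ ℓ × r ≤ cnt p ws
        go : ∀ k xs → length xs ≤ k → r * (length xs + ℓ) ≤ cnt p xs * ℓ → Goal xs
        go zero [] _ h = [] , [] , [] , refl , z≤n , *-cancelʳ-≤ r 0 ℓ h
        go (suc k) xs len h with length xs ≤? ℓ
        ... | yes short = [] , xs , [] , ≡.sym (++-identityʳ xs) , short ,
              *-cancelʳ-≤ r (cnt p xs) ℓ (≤-trans (*-monoʳ-≤ r (m≤n+m ℓ (length xs))) h)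
        ... | no long with r ≤? cnt p (take ℓ xs)
        ...   | yes dense = [] , take ℓ xs , drop ℓ xs , ≡.sym (take++drop≡id ℓ xs) ,
                ≤-trans (≤-reflexive (length-take ℓ xs)) (m⊓n≤m ℓ (length xs)) , dense
        ...   | no sparse with go k (drop ℓ xs) len′ h′
          where
          open ≤-Reasoning
          ℓ≤ : ℓ ≤ length xs
          ℓ≤ = <⇒≤ (≰⇒> long)
          len′ : length (drop ℓ xs) ≤ k
          len′ = begin
            length (drop ℓ xs)  ≡⟨ length-drop ℓ xs ⟩
            length xs ∸ ℓ       ≤⟨ ∸-mono len 0<ℓ ⟩
            k                   ∎
          ∸+ : length (drop ℓ xs) + ℓ ≡ length xs
          ∸+ = ≡.trans (cong (_+ ℓ) (length-drop ℓ xs)) (m∸n+n≡m ℓ≤)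
          h′ : r * (length (drop ℓ xs) + ℓ) ≤ cnt p (drop ℓ xs) * ℓ
          h′ = +-cancelˡ-≤ (r * ℓ) _ _ (begin
            r * ℓ + r * (length (drop ℓ xs) + ℓ)             ≡⟨ cong (λ z → r * ℓ + r * z) ∸+ ⟩
            r * ℓ + r * length xs                            ≡⟨ +-comm (r * ℓ) _ ⟩
            r * length xs + r * ℓ                            ≡⟨ *-distribˡ-+ r (length xs) ℓ ⟨
            r * (length xs + ℓ)                              ≤⟨ h ⟩
            cnt p xs * ℓ                                     ≡⟨ cong (λ z → cnt p z * ℓ) (take++drop≡id ℓ xs) ⟨
            cnt p (take ℓ xs ++ drop ℓ xs) * ℓ               ≡⟨ cong (_* ℓ) (cnt-++ p (take ℓ xs) (drop ℓ xs)) ⟩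
            (cnt p (take ℓ xs) + cnt p (drop ℓ xs)) * ℓ      ≡⟨ *-distribʳ-+ ℓ (cnt p (take ℓ xs)) _ ⟩
            cnt p (take ℓ xs) * ℓ + cnt p (drop ℓ xs) * ℓ    ≤⟨ +-monoˡ-≤ _ (*-monoˡ-≤ ℓ (<⇒≤ (≰⇒> sparse))) ⟩
            r * ℓ + cnt p (drop ℓ xs) * ℓ                    ∎)
        ...     | as , ws , bs , eq , short , dense = take ℓ xs ++ as , ws , bs ,
                  ≡.trans (≡.sym (take++drop≡id ℓ xs))
                    (≡.trans (cong (take ℓ xs ++_) eq) (≡.sym (++-assoc (take ℓ xs) as (ws ++ bs)))) ,
                  short , dense

  -- Defects of an ordering and the closing exchange

  module Tours {n : ℕ} (Γ : Graph n) where

    V : Set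
    V = Fin n

    infix 4 _~_
    _~_ : V → V → Set
    u ~ v = adj Γ u v ≡ true

    ~-sym : ∀ {u v} → u ~ v → v ~ u
    ~-sym {u} {v} = ≡.trans (sym Γ v u)

    defect : V → V → ℕ
    defect u v = if adj Γ u v then 0 else 1

    defect-sym : ∀ u v → defect u v ≡ defect v u
    defect-sym u v = cong (λ b → if b then 0 else 1) (sym Γ u v)

    defect-~ : ∀ {u v} → u ~ v → defect u v ≡ 0
    defect-~ = cong (λ b → if b then 0 else 1)

    -- The pair formed by the last and the first vertex is not counted; `Closed` takes care of it
    -- separately.
    bad : List V → ℕ
    bad (x ∷ y ∷ zs) = defect x y + bad (y ∷ zs)
    bad _            = 0

    bad-∷ʳ-∷ : ∀ xs x y ys → bad (xs ++ x ∷ y ∷ ys) ≡ bad (xs ++ x ∷ []) + (defect x y + bad (y ∷ ys))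
    bad-∷ʳ-∷ []            x y ys = refl
    bad-∷ʳ-∷ (z ∷ [])      x y ys = cong (_+ bad (x ∷ y ∷ ys)) (≡.sym (+-identityʳ (defect z x)))
    bad-∷ʳ-∷ (z ∷ z′ ∷ zs) x y ys = ≡.trans
      (cong (defect z z′ +_) (bad-∷ʳ-∷ (z′ ∷ zs) x y ys))
      (≡.sym (+-assoc (defect z z′) (bad (z′ ∷ zs ++ x ∷ [])) _))

    bad-reverse : ∀ xs → bad (reverse xs) ≡ bad xs
    bad-reverse []           = refl
    bad-reverse (x ∷ [])     = refl
    bad-reverse (x ∷ y ∷ ys) = begin
      bad (reverse (x ∷ y ∷ ys))                       ≡⟨ cong bad (unfold-reverse x (y ∷ ys)) ⟩
      bad (reverse (y ∷ ys) ++ x ∷ [])                 ≡⟨ cong (λ zs → bad (zs ++ x ∷ [])) (unfold-reverse y ys) ⟩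
      bad ((reverse ys ++ y ∷ []) ++ x ∷ [])           ≡⟨ cong bad (++-assoc (reverse ys) (y ∷ []) (x ∷ [])) ⟩
      bad (reverse ys ++ y ∷ x ∷ [])                   ≡⟨ bad-∷ʳ-∷ (reverse ys) y x [] ⟩
      bad (reverse ys ++ y ∷ []) + (defect y x + 0)    ≡⟨ cong₂ _+_ (cong bad (≡.sym (unfold-reverse y ys))) (+-identityʳ _) ⟩
      bad (reverse (y ∷ ys)) + defect y x              ≡⟨ cong₂ _+_ (bad-reverse (y ∷ ys)) (defect-sym y x) ⟩
      bad (y ∷ ys) + defect x y                        ≡⟨ +-comm (bad (y ∷ ys)) _ ⟩
      defect x y + bad (y ∷ ys)                        ∎
      where open ≡.≡-Reasoning

    -- A cut can only lose a defect, the one at the junction. Together with `bad-++-≤`, where the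
    -- junction is an edge, this shows that cutting a list anywhere, reversing pieces and gluing
    -- them along edges creates no defect.
    bad-++-≥ : ∀ xs ys → bad xs + bad ys ≤ bad (xs ++ ys)
    bad-++-≥ []            ys       = ≤-refl
    bad-++-≥ (x ∷ [])      []       = z≤n
    bad-++-≥ (x ∷ [])      (y ∷ ys) = m≤n+m _ (defect x y)
    bad-++-≥ (x ∷ x′ ∷ xs) ys       = begin
      defect x x′ + bad (x′ ∷ xs) + bad ys    ≡⟨ +-assoc (defect x x′) _ _ ⟩
      defect x x′ + (bad (x′ ∷ xs) + bad ys)  ≤⟨ +-monoʳ-≤ (defect x x′) (bad-++-≥ (x′ ∷ xs) ys) ⟩
      defect x x′ + bad (x′ ∷ xs ++ ys)       ∎
      where open ≤-Reasoning

    bad-++-≤ : ∀ {x y} xs ys → Ends x xs → Starts y ys → x ~ y → bad (xs ++ ys) ≤ bad xs + bad ys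
    bad-++-≤ {x} {y} xs .(y ∷ ys) e (starts ys) x~y with ends⇒∷ʳ xs e
    ... | zs , refl = ≤-reflexive (begin
      bad ((zs ++ x ∷ []) ++ y ∷ ys)                 ≡⟨ cong bad (++-assoc zs (x ∷ []) (y ∷ ys)) ⟩
      bad (zs ++ x ∷ y ∷ ys)                         ≡⟨ bad-∷ʳ-∷ zs x y ys ⟩
      bad (zs ++ x ∷ []) + (defect x y + bad (y ∷ ys)) ≡⟨ cong (λ d → bad (zs ++ x ∷ []) + (d + bad (y ∷ ys))) (defect-~ x~y) ⟩
      bad (zs ++ x ∷ []) + bad (y ∷ ys)              ∎)
      where open ≡.≡-Reasoning

    Closed : List V → Set
    Closed P = ∃₂ λ x y → Starts x P × Ends y P × y ~ x

    Closing : List V → Set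
    Closing P = ∃ λ P′ → P′ ↭ P × bad P′ ≤ bad P × Closed P′

    -- The Pósa exchange: reversing the second half of `f … a b … v` gives `f … a v … b`. The new
    -- junction is the edge `v ~ a`, and `f ~ b` joins the two ends.
    close : ∀ {f v a b} Q → Starts f Q → Ends v Q → Link a b Q → v ~ a → f ~ b → Closing Q
    close {f} {v} {a} {b} .(U ++ W) sQ eQ (U , W , refl , aU , bW) v~a f~b =
      U ++ reverse W , ↭-++⁺ˡ U (↭-reverse W) , bound ,
      f , b , starts-++ (reverse W) (starts-++⁻ U aU sQ) , ends-++ U (starts-reverse W bW) , ~-sym f~b
      where
      open ≤-Reasoning
      bound : bad (U ++ reverse W) ≤ bad (U ++ W)
      bound = begin
        bad (U ++ reverse W)      ≤⟨ bad-++-≤ U (reverse W) aU (ends-++⁻ U bW eQ) (~-sym v~a) ⟩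
        bad U + bad (reverse W)   ≡⟨ cong (bad U +_) (bad-reverse W) ⟩
        bad U + bad W             ≤⟨ bad-++-≥ U W ⟩
        bad (U ++ W)              ∎

    bad-++₃-≥ : ∀ xs ys zs → bad xs + (bad ys + bad zs) ≤ bad (xs ++ ys ++ zs)
    bad-++₃-≥ xs ys zs = ≤-trans (+-monoʳ-≤ (bad xs) (bad-++-≥ ys zs)) (bad-++-≥ xs (ys ++ zs))

    bad-++₃-≤ : ∀ {u v w x} xs ys zs → Ends u xs → Starts v ys → u ~ v → Ends w ys → Starts x zs → w ~ x →
      bad (xs ++ ys ++ zs) ≤ bad xs + (bad ys + bad zs)
    bad-++₃-≤ xs ys zs eu sv u~v ew sx w~x =
      ≤-trans (bad-++-≤ xs (ys ++ zs) eu (starts-++ zs sv) u~v)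
              (+-monoʳ-≤ (bad xs) (bad-++-≤ ys zs ew sx w~x))

    -- Expansion and pairs that allow an exchange

    -- Uniqueness of `xs ++ ts` says at once that both lists are free of repetitions and that they
    -- are disjoint, so lengths are sizes of sets.
    Expands : ℕ → ℕ → Set
    Expands s t = ∀ xs ts → Unique (xs ++ ts) → s ≤ length xs → t ≤ length ts →
      ∃₂ λ x y → x ∈ xs × y ∈ ts × x ~ y

    -- Sort the pairs by whether the first entry has a neighbour in `xs`. If at least `t` of them
    -- do, expansion between `fs` and their second entries yields the pair. Otherwise at least `t`
    -- of them do not, and expansion between `xs` and those first entries is contradictory.
    crossing : ∀ {s t} → Expands s t → ∀ xs fs ls →
      Unique (xs ++ map proj₁ ls) → Unique (fs ++ map proj₂ ls) →
      s ≤ length xs → s ≤ length fs → t + t ≤ length ls →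
      ∃₂ λ a b → ∃₂ λ x f → (a , b) ∈ ls × x ∈ xs × f ∈ fs × x ~ a × f ~ b
    crossing {s} {t} expands xs fs ls u₁ u₂ s≤xs s≤fs 2t≤ls = go (t ≤? length yes-ls)
      where
      Meets : V × V → Set
      Meets l = Any (λ x → x ~ proj₁ l) xs
      meets? : Decidable Meets
      meets? l = any? (λ x → adj Γ x (proj₁ l) Bool.≟ true) xs
      yes-ls no-ls : List (V × V)
      yes-ls = filter meets? ls
      no-ls  = filter (¬? ∘ meets?) ls
      restrict : ∀ (π : V × V → V) {ls′} zs → ls′ ⊆ ls → Unique (zs ++ map π ls) → Unique (zs ++ map π ls′)
      restrict π zs sub = unique-⊆ (Sub.++⁺ (⊆-refl {x = zs}) (Sub.map⁺ π sub))
      ≤-map : ∀ (π : V × V → V) ls′ → t ≤ length ls′ → t ≤ length (map π ls′)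
      ≤-map π ls′ = subst (t ≤_) (≡.sym (length-map π ls′))
      go : Dec (t ≤ length yes-ls) → _
      go (yes many) with expands fs (map proj₂ yes-ls) (restrict proj₂ fs (Sub.filter-⊆ meets? ls) u₂) s≤fs (≤-map proj₂ yes-ls many)
      ... | f , b , f∈ , b∈ , f~b with ∈-map⁻ proj₂ b∈
      ... | (a , _) , ab∈ , refl with ∈-filter⁻ meets? {xs = ls} ab∈
      ... | ab∈ls , meets with find meets
      ... | x , x∈ , x~a = a , b , x , f , ab∈ls , x∈ , f∈ , x~a , f~b
      go (no few) with expands xs (map proj₁ no-ls) (restrict proj₁ xs (Sub.filter-⊆ (¬? ∘ meets?) ls) u₁) s≤xs (≤-map proj₁ no-ls many)
        where
        open ≤-Reasoning
        many : t ≤ length no-ls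
        many = +-cancelˡ-≤ t _ _ (begin
          t + t                          ≤⟨ 2t≤ls ⟩
          length ls                      ≤⟨ length-filter-split meets? ls ⟩
          length yes-ls + length no-ls   ≤⟨ +-monoˡ-≤ _ (<⇒≤ (≰⇒> few)) ⟩
          t + length no-ls               ∎)
      ... | x , a , x∈ , a∈ , x~a with ∈-map⁻ proj₁ a∈
      ... | ab , ab∈ , refl = contradiction (lose x∈ x~a) (proj₂ (∈-filter⁻ (¬? ∘ meets?) {xs = ls} ab∈))

    -- Rerouting an ordering with free choice of both ends

    links₃ : (X Y Z : List V) → List (V × V)
    links₃ X Y Z = links X ++ links Y ++ links Z

    ∈-links₃⁻ : ∀ {a b} X Y Z → (a , b) ∈ links₃ X Y Z → Link a b X ⊎ Link a b Y ⊎ Link a b Z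
    ∈-links₃⁻ X Y Z l with ∈-++⁻ (links X) l
    ... | inj₁ l₁ = inj₁ (∈-links⁻ X l₁)
    ... | inj₂ l₂ with ∈-++⁻ (links Y) l₂
    ...   | inj₁ l₃ = inj₂ (inj₁ (∈-links⁻ Y l₃))
    ...   | inj₂ l₄ = inj₂ (inj₂ (∈-links⁻ Z l₄))

    map-links₃-⊆ : ∀ (π : V × V → V) → (∀ xs → map π (links xs) ⊆ xs) →
      ∀ X Y Z → map π (links₃ X Y Z) ⊆ X ++ Y ++ Z
    map-links₃-⊆ π sub X Y Z
      rewrite map-++ π (links X) (links Y ++ links Z) | map-++ π (links Y) (links Z) =
      Sub.++⁺ (sub X) (Sub.++⁺ (sub Y) (sub Z))

    length-links₃ : ∀ X Y Z → length X + (length Y + length Z) ≤ length (links₃ X Y Z) + 3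
    length-links₃ X Y Z
      rewrite length-++ (links X) {links Y ++ links Z} | length-++ (links Y) {links Z} = begin
      length X + (length Y + length Z)     ≤⟨ +-mono-≤ (length-links X) (+-mono-≤ (length-links Y) (length-links Z)) ⟩
      suc x + (suc y + suc z)              ≡⟨ solve 3 (λ x y z → (con 1 :+ x) :+ ((con 1 :+ y) :+ (con 1 :+ z)) := (x :+ (y :+ z)) :+ con 3) refl x y z ⟩
      x + (y + z) + 3                      ∎
      where
      open ≤-Reasoning
      open +-*-Solver
      x = length (links X)
      y = length (links Y)
      z = length (links Z)

    Reroute : List V → V → V → List (V × V) → Set
    Reroute P f v ls = ∃ λ Q → Q ↭ P × bad Q ≤ bad P × Starts f Q × Ends v Q ×
      (∀ {a b} → (a , b) ∈ ls → Link a b Q)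

    -- `crossing` selects the pair and the two new ends simultaneously, so the pairs offered to it
    -- have to survive the reroute for every choice of ends. Those inside the fixed segments `X`,
    -- `Y`, `Z` do. The `3` accounts for each segment having possibly one link fewer than it has
    -- vertices.
    closing-from-reroutes : ∀ {s t} → Expands s t → ∀ {P I J fs xs} X Y Z →
      Unique P → P ↭ I ++ J ++ X ++ Y ++ Z → fs ⊆ I → xs ⊆ J → s ≤ length fs → s ≤ length xs →
      t + t + 3 ≤ length X + (length Y + length Z) →
      (∀ {f v} → f ∈ fs → v ∈ xs → Reroute P f v (links₃ X Y Z)) → Closing P
    closing-from-reroutes {t = t} expands {P} {I} {J} {fs} {xs} X Y Z uP P↭ fs⊆I xs⊆J s≤fs s≤xs long reroute
      with crossing {t = t} expands xs fs (links₃ X Y Z) u₁ u₂ s≤xs s≤fs (+-cancelʳ-≤ 3 _ _ (≤-trans long (length-links₃ X Y Z)))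
      where
      u : Unique (I ++ J ++ X ++ Y ++ Z)
      u = unique-↭ P↭ uP
      u₁ : Unique (xs ++ map proj₁ (links₃ X Y Z))
      u₁ = unique-⊆ (Sub.++⁺ˡ I (Sub.++⁺ xs⊆J (map-links₃-⊆ proj₁ links₁-⊆ X Y Z))) u
      u₂ : Unique (fs ++ map proj₂ (links₃ X Y Z))
      u₂ = unique-⊆ (Sub.++⁺ fs⊆I (Sub.++⁺ˡ J (map-links₃-⊆ proj₂ links₂-⊆ X Y Z))) u
    ... | a , b , x , f , ab∈ , x∈ , f∈ , x~a , f~b with reroute f∈ x∈
    ... | Q , Q↭P , Q≤P , sQ , eQ , keeps with close Q sQ eQ (keeps ab∈) x~a f~b
    ... | P′ , P′↭Q , P′≤Q , closed = P′ , ↭-trans P′↭Q Q↭P , ≤-trans P′≤Q Q≤P , closed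

    -- The case where the neighbour of `p` comes first: `p … f`, `g … h`, `v … q` become `f … p`,
    -- `g … h`, `q … v`, and the junctions are the edges `p ~ g` and `h ~ q`.
    three-rotations₁ : ∀ {p f g h v q} L M R → Starts p (L ++ M ++ R) → Ends q (L ++ M ++ R) →
      Ends f L → Starts g M → Ends h M → Starts v R → p ~ g → q ~ h →
      let Q = reverse L ++ M ++ reverse R in
      Q ↭ L ++ M ++ R × bad Q ≤ bad (L ++ M ++ R) × Starts f Q × Ends v Q
    three-rotations₁ {p} {f} {g} {h} {v} {q} L M R sp eq fL gM hM vR p~g q~h =
      ↭-++⁺ (↭-reverse L) (↭-++⁺ˡ M (↭-reverse R)) , bound ,
      starts-++ (M ++ reverse R) fL , ends-++ (reverse L) (ends-++ M (starts-reverse R vR))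
      where
      pL : Starts p L
      pL = starts-++⁻ L fL sp
      qR : Ends q R
      qR = ends-++⁻ M vR (ends-++⁻ L (starts-++ R gM) eq)
      open ≤-Reasoning
      bound : bad (reverse L ++ M ++ reverse R) ≤ bad (L ++ M ++ R)
      bound = begin
        bad (reverse L ++ M ++ reverse R)             ≤⟨ bad-++₃-≤ (reverse L) M (reverse R) (starts-reverse L pL) gM p~g hM qR (~-sym q~h) ⟩
        bad (reverse L) + (bad M + bad (reverse R))   ≡⟨ cong₂ _+_ (bad-reverse L) (cong (bad M +_) (bad-reverse R)) ⟩
        bad L + (bad M + bad R)                       ≤⟨ bad-++₃-≥ L M R ⟩
        bad (L ++ M ++ R)                             ∎

    -- The case where the neighbour of `q` comes first: `p … v`, `h … f`, `g … q` become `f … h`,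
    -- `q … g`, `p … v`, and the junctions are the edges `h ~ q` and `g ~ p`.
    three-rotations₂ : ∀ {p v h f g q} L M R → Starts p (L ++ M ++ R) → Ends q (L ++ M ++ R) →
      Ends v L → Starts h M → Ends f M → Starts g R → p ~ g → q ~ h →
      let Q = reverse M ++ reverse R ++ L in
      Q ↭ L ++ M ++ R × bad Q ≤ bad (L ++ M ++ R) × Starts f Q × Ends v Q
    three-rotations₂ {p} {v} {h} {f} {g} {q} L M R sp eq vL hM fM gR p~g q~h =
      perm , bound , starts-++ (reverse R ++ L) fM , ends-++ (reverse M) (ends-++ (reverse R) {L} vL)
      where
      pL : Starts p L
      pL = starts-++⁻ L vL sp
      qR : Ends q R
      qR = ends-++⁻ M gR (ends-++⁻ L (starts-++ R hM) eq)
      perm : reverse M ++ reverse R ++ L ↭ L ++ M ++ R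
      perm = begin
        reverse M ++ reverse R ++ L   ↭⟨ ↭-++⁺ (↭-reverse M) (↭-++⁺ (↭-reverse R) ↭-refl) ⟩
        M ++ R ++ L                   ≡⟨ ++-assoc M R L ⟨
        (M ++ R) ++ L                 ↭⟨ ++-comm (M ++ R) L ⟩
        L ++ M ++ R                   ∎
        where open PermutationReasoning
      open ≤-Reasoning
      bound : bad (reverse M ++ reverse R ++ L) ≤ bad (L ++ M ++ R)
      bound = begin
        bad (reverse M ++ reverse R ++ L)             ≤⟨ bad-++₃-≤ (reverse M) (reverse R) L (starts-reverse M hM) qR (~-sym q~h) (starts-reverse R gR) pL (~-sym p~g) ⟩
        bad (reverse M) + (bad (reverse R) + bad L)   ≡⟨ cong₂ _+_ (bad-reverse M) (cong (_+ bad L) (bad-reverse R)) ⟩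
        bad M + (bad R + bad L)                       ≡⟨ +-assoc (bad M) (bad R) (bad L) ⟨
        bad M + bad R + bad L                         ≡⟨ +-comm (bad M + bad R) (bad L) ⟩
        bad L + (bad M + bad R)                       ≤⟨ bad-++₃-≥ L M R ⟩
        bad (L ++ M ++ R)                             ∎

    tails-link : ∀ {p f} I → f ∈ map proj₁ (tails (adj Γ p) I) → ∃ λ g → Link f g I × p ~ g
    tails-link {p} I f∈ with ∈-map⁻ proj₁ f∈
    ... | (_ , g) , fg∈ , refl with ∈-filter⁻ (λ l → adj Γ p (proj₂ l) Bool.≟ true) {xs = links I} fg∈
    ... | fg∈I , p~g = g , ∈-links⁻ I fg∈I , p~g

    heads-link : ∀ {p v} I → v ∈ map proj₂ (heads (adj Γ p) I) → ∃ λ h → Link h v I × p ~ h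
    heads-link {p} I v∈ with ∈-map⁻ proj₂ v∈
    ... | (h , _) , hv∈ , refl with ∈-filter⁻ (λ l → adj Γ p (proj₁ l) Bool.≟ true) {xs = links I} hv∈
    ... | hv∈I , p~h = h , ∈-links⁻ I hv∈I , p~h

    map-tails-⊆ : ∀ (p : V → Bool) I → map proj₁ (tails p I) ⊆ I
    map-tails-⊆ p I = ⊆-trans (Sub.map⁺ proj₁ (Sub.filter-⊆ _ (links I))) (links₁-⊆ I)

    map-heads-⊆ : ∀ (p : V → Bool) I → map proj₂ (heads p I) ⊆ I
    map-heads-⊆ p I = ⊆-trans (Sub.map⁺ proj₂ (Sub.filter-⊆ _ (links I))) (links₂-⊆ I)

    length-map-tails : ∀ {s} (p : V → Bool) I → suc s ≤ cnt p I → s ≤ length (map proj₁ (tails p I))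
    length-map-tails {s} p I dense = subst (s ≤_) (≡.sym (length-map proj₁ (tails p I))) (≤-pred (≤-trans dense (cnt≤tails p I)))

    length-map-heads : ∀ {s} (p : V → Bool) I → suc s ≤ cnt p I → s ≤ length (map proj₂ (heads p I))
    length-map-heads {s} p I dense = subst (s ≤_) (≡.sym (length-map proj₂ (heads p I))) (≤-pred (≤-trans dense (cnt≤heads p I)))

    link-cast : ∀ {a b : V} {xs ys} → xs ≡ ys → Link a b xs → Link a b ys
    link-cast refl l = l

    reroute-cast : ∀ {P P′ f v ls} → P ≡ P′ → Reroute P f v ls → Reroute P′ f v ls
    reroute-cast refl r = r

    -- The window of `p` precedes that of `q`. The new first vertex is the predecessor of a
    -- neighbour of `p`, the new last vertex the successor of a neighbour of `q`; hence `tails` in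
    -- `I` but `heads` in `J`. Every such reroute traverses `A` and `C` backwards and `B` forwards,
    -- which fixes the direction of the pairs kept.
    closing₁ : ∀ {s t p q} → Expands s t → ∀ A I B J C → let P = A ++ I ++ B ++ J ++ C in
      Unique P → Starts p P → Ends q P → suc s ≤ cnt (adj Γ p) I → suc s ≤ cnt (adj Γ q) J →
      t + t + 3 ≤ length A + (length B + length C) → Closing P
    closing₁ {t = t} {p} {q} expands A I B J C uP sp eq dI dJ long =
      closing-from-reroutes expands {I = I} {J} (reverse A) B (reverse C) uP perm
        (map-tails-⊆ (adj Γ p) I) (map-heads-⊆ (adj Γ q) J)
        (length-map-tails (adj Γ p) I dI) (length-map-heads (adj Γ q) J dJ) long′ reroute
      where
      P = A ++ I ++ B ++ J ++ C
      perm : P ↭ I ++ J ++ reverse A ++ B ++ reverse C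
      perm = ↭-trans
        (solve 5 (λ a i b j c → a ⊕ i ⊕ b ⊕ j ⊕ c ⊜ i ⊕ j ⊕ a ⊕ b ⊕ c) ↭-refl A I B J C)
        (↭-++⁺ˡ I (↭-++⁺ˡ J (↭-++⁺ (↭-sym (↭-reverse A)) (↭-++⁺ˡ B (↭-sym (↭-reverse C))))))
        where open CommutativeMonoidSolver (↭-++-commutativeMonoid {A = V})
      long′ : t + t + 3 ≤ length (reverse A) + (length B + length (reverse C))
      long′ rewrite length-reverse A | length-reverse C = long
      reroute : ∀ {f v} → f ∈ map proj₁ (tails (adj Γ p) I) → v ∈ map proj₂ (heads (adj Γ q) J) →
        Reroute P f v (links₃ (reverse A) B (reverse C))
      reroute {f} {v} f∈ v∈ with tails-link I f∈ | heads-link J v∈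
      ... | g , (I₁ , I₂ , refl , fI₁ , gI₂) , p~g | h , (J₁ , J₂ , refl , hJ₁ , vJ₂) , q~h =
        reroute-cast (≡.sym P≡) (reverse L ++ M ++ reverse R , Q↭ , Q≤ , sQ , eQ , keeps)
        where
        L = A ++ I₁
        M = I₂ ++ B ++ J₁
        R = J₂ ++ C
        P≡ : A ++ (I₁ ++ I₂) ++ B ++ (J₁ ++ J₂) ++ C ≡ L ++ M ++ R
        P≡ = solve 7 (λ a i₁ i₂ b j₁ j₂ c → a ⊕ (i₁ ⊕ i₂) ⊕ b ⊕ (j₁ ⊕ j₂) ⊕ c ⊜ (a ⊕ i₁) ⊕ (i₂ ⊕ b ⊕ j₁) ⊕ (j₂ ⊕ c)) refl A I₁ I₂ B J₁ J₂ C
          where open MonoidSolver (++-monoid V)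
        rotated = three-rotations₁ L M R (subst (Starts p) P≡ sp) (subst (Ends q) P≡ eq)
          (ends-++ A {I₁} fI₁) (starts-++ (B ++ J₁) gI₂) (ends-++ I₂ (ends-++ B {J₁} hJ₁)) (starts-++ C vJ₂) p~g q~h
        Q↭ = proj₁ rotated
        Q≤ = proj₁ (proj₂ rotated)
        sQ = proj₁ (proj₂ (proj₂ rotated))
        eQ = proj₂ (proj₂ (proj₂ rotated))
        keeps : ∀ {a b} → (a , b) ∈ links₃ (reverse A) B (reverse C) → Link a b (reverse L ++ M ++ reverse R)
        keeps ab∈ with ∈-links₃⁻ (reverse A) B (reverse C) ab∈
        ... | inj₁ l        = link-++ʳ (reverse L) (link-cast (≡.sym (reverse-++ A I₁)) (link-++ˡ (reverse I₁) l))
        ... | inj₂ (inj₁ l) = link-++ˡ (reverse L) (link-++ʳ M (link-++ˡ I₂ (link-++ʳ B l)))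
        ... | inj₂ (inj₂ l) = link-++ˡ (reverse L) (link-++ˡ M (link-cast (≡.sym (reverse-++ J₂ C)) (link-++ʳ (reverse C) l)))

    -- With the windows in the opposite order both new ends are predecessors of neighbours, so
    -- `tails` is used twice. Now `B` and `C` are traversed backwards and `A` forwards.
    closing₂ : ∀ {s t p q} → Expands s t → ∀ A J B I C → let P = A ++ J ++ B ++ I ++ C in
      Unique P → Starts p P → Ends q P → suc s ≤ cnt (adj Γ p) I → suc s ≤ cnt (adj Γ q) J →
      t + t + 3 ≤ length A + (length B + length C) → Closing P
    closing₂ {t = t} {p} {q} expands A J B I C uP sp eq dI dJ long =
      closing-from-reroutes expands {I = I} {J} (reverse B) (reverse C) A uP perm
        (map-tails-⊆ (adj Γ p) I) (map-tails-⊆ (adj Γ q) J)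
        (length-map-tails (adj Γ p) I dI) (length-map-tails (adj Γ q) J dJ) long′ reroute
      where
      P = A ++ J ++ B ++ I ++ C
      perm : P ↭ I ++ J ++ reverse B ++ reverse C ++ A
      perm = ↭-trans
        (solve 5 (λ a j b i c → a ⊕ j ⊕ b ⊕ i ⊕ c ⊜ i ⊕ j ⊕ b ⊕ c ⊕ a) ↭-refl A J B I C)
        (↭-++⁺ˡ I (↭-++⁺ˡ J (↭-++⁺ (↭-sym (↭-reverse B)) (↭-++⁺ (↭-sym (↭-reverse C)) ↭-refl))))
        where open CommutativeMonoidSolver (↭-++-commutativeMonoid {A = V})
      long′ : t + t + 3 ≤ length (reverse B) + (length (reverse C) + length A)
      long′ rewrite length-reverse B | length-reverse C =
        ≤-trans long (≤-reflexive (≡.trans (+-comm (length A) _) (+-assoc (length B) _ _)))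
      reroute : ∀ {f v} → f ∈ map proj₁ (tails (adj Γ p) I) → v ∈ map proj₁ (tails (adj Γ q) J) →
        Reroute P f v (links₃ (reverse B) (reverse C) A)
      reroute {f} {v} f∈ v∈ with tails-link I f∈ | tails-link J v∈
      ... | g , (I₁ , I₂ , refl , fI₁ , gI₂) , p~g | h , (J₁ , J₂ , refl , vJ₁ , hJ₂) , q~h =
        reroute-cast (≡.sym P≡) (reverse M ++ reverse R ++ L , Q↭ , Q≤ , sQ , eQ , keeps)
        where
        L = A ++ J₁
        M = J₂ ++ B ++ I₁
        R = I₂ ++ C
        P≡ : A ++ (J₁ ++ J₂) ++ B ++ (I₁ ++ I₂) ++ C ≡ L ++ M ++ R
        P≡ = solve 7 (λ a i₁ i₂ b j₁ j₂ c → a ⊕ (i₁ ⊕ i₂) ⊕ b ⊕ (j₁ ⊕ j₂) ⊕ c ⊜ (a ⊕ i₁) ⊕ (i₂ ⊕ b ⊕ j₁) ⊕ (j₂ ⊕ c)) refl A J₁ J₂ B I₁ I₂ C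
          where open MonoidSolver (++-monoid V)
        rotated = three-rotations₂ L M R (subst (Starts p) P≡ sp) (subst (Ends q) P≡ eq)
          (ends-++ A {J₁} vJ₁) (starts-++ (B ++ I₁) hJ₂) (ends-++ J₂ (ends-++ B {I₁} fI₁)) (starts-++ C gI₂) p~g q~h
        Q↭ = proj₁ rotated
        Q≤ = proj₁ (proj₂ rotated)
        sQ = proj₁ (proj₂ (proj₂ rotated))
        eQ = proj₂ (proj₂ (proj₂ rotated))
        keeps : ∀ {a b} → (a , b) ∈ links₃ (reverse B) (reverse C) A → Link a b (reverse M ++ reverse R ++ L)
        keeps ab∈ with ∈-links₃⁻ (reverse B) (reverse C) A ab∈
        ... | inj₁ l        = link-++ʳ (reverse M) (link-cast (≡.sym M⁻¹) (link-++ˡ (reverse I₁) (link-++ʳ (reverse B) l)))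
          where
          M⁻¹ : reverse M ≡ reverse I₁ ++ reverse B ++ reverse J₂
          M⁻¹ = ≡.trans (reverse-++ J₂ (B ++ I₁)) (≡.trans (cong (_++ reverse J₂) (reverse-++ B I₁)) (++-assoc (reverse I₁) (reverse B) (reverse J₂)))
        ... | inj₂ (inj₁ l) = link-++ˡ (reverse M) (link-++ʳ (reverse R) (link-cast (≡.sym (reverse-++ I₂ C)) (link-++ʳ (reverse C) l)))
        ... | inj₂ (inj₂ l) = link-++ˡ (reverse M) (link-++ˡ (reverse R) (link-++ʳ A l))

  -- Removing all defects and reading off a Hamilton cycle

  next-cases : ∀ {n} (i : Fin n) → toℕ (next i) ≡ suc (toℕ i) ⊎ (suc (toℕ i) ≡ n × toℕ (next i) ≡ 0)
  next-cases {suc m} i with m≤n⇒m<n∨m≡n (toℕ<n i)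
  ... | inj₁ less = inj₁ (≡.trans (toℕ-fromℕ< (m%n<n (suc (toℕ i)) (suc m))) (m<n⇒m%n≡m less))
  ... | inj₂ last = inj₂ (last , ≡.trans (toℕ-fromℕ< (m%n<n (suc (toℕ i)) (suc m)))
                           (≡.trans (cong (_% suc m) last) (n%n≡0 (suc m))))

  module Hamiltonicity {n : ℕ} (Γ : Graph n) where
    open Tours Γ

    ends-exists : ∀ (x : V) xs → ∃ λ y → Ends y (x ∷ xs)
    ends-exists x []       = x , starts []
    ends-exists x (y ∷ ys) with ends-exists y ys
    ... | z , e = z , ends-++ (x ∷ []) {y ∷ ys} e

    -- The cut is made at the first defect, which then lies inside neither piece.
    cut-defect : ∀ x xs → 0 < bad (x ∷ xs) → ∃₂ λ a b → ∃₂ λ U W →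
      x ∷ xs ≡ U ++ W × Ends a U × Starts b W × bad U + bad W < bad (x ∷ xs)
    cut-defect x (y ∷ zs) 0<bad with adj Γ x y in x~y
    ... | false = x , y , x ∷ [] , y ∷ zs , refl , starts [] , starts zs , ≤-refl
    ... | true with cut-defect y zs 0<bad
    ...   | a , b , U , W , eq , aU , bW , less = a , b , x ∷ U , W , cong (x ∷_) eq , ends-++ (x ∷ []) {U} aU , bW ,
            ≤-<-trans (+-monoˡ-≤ (bad W) (bad-++-≤ (x ∷ []) U (starts []) yU x~y)) less
      where
      yU : Starts y U
      yU = starts-++⁻ U aU (subst (Starts y) eq (starts zs))

    module _ {s t ℓ c : ℕ} (expands : Expands s t) (0<ℓ : 0 < ℓ) (min-degree : ∀ v → c + ℓ ≤ degree Γ v)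
             (dense : suc s * (n + (ℓ + ℓ)) ≤ c * ℓ) (room : t + t + 3 + (ℓ + ℓ) ≤ n) where

      -- First a dense window `I` for the first vertex `p` is found. The last vertex `q` then has a
      -- dense window either before or after `I`, and these two orders are the cases `closing₂` and
      -- `closing₁`.
      closing : ∀ P → P ↭ allFin n → Closing P
      -- An empty ordering would give `n ≡ 0`, whereas `room` makes `n` at least 3.
      closing [] []↭ = contradiction (≤-trans (m≤n+m 3 (t + t)) (m+n≤o⇒m≤o _ room)) (<⇒≱ (≤-trans (≤-reflexive (cong suc n≡0)) (s≤s z≤n)))
        where
        n≡0 : n ≡ 0
        n≡0 = ≡.trans (≡.sym (length-tabulate (λ i → i))) (≡.sym (↭-length []↭))
      closing P@(p ∷ ps) P↭ with ends-exists p ps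
      ... | q , eP = go
        where
        open ≤-Reasoning
        r = suc s
        sP : Starts p P
        sP = starts ps
        |P| : length P ≡ n
        |P| = ≡.trans (↭-length P↭) (length-tabulate (λ i → i))
        uP : Unique P
        uP = unique-↭ (↭-sym P↭) (allFin⁺ n)
        many : ∀ v → c + ℓ ≤ cnt (adj Γ v) P
        many v = ≤-trans (min-degree v) (≤-reflexive (≡.sym (cnt-↭ (adj Γ v) P↭)))
        hyp₁ : r * (length P + ℓ) ≤ cnt (adj Γ p) P * ℓ
        hyp₁ = begin
          r * (length P + ℓ)       ≤⟨ *-monoʳ-≤ r (+-mono-≤ (≤-reflexive |P|) (m≤m+n ℓ ℓ)) ⟩
          r * (n + (ℓ + ℓ))        ≤⟨ dense ⟩
          c * ℓ                    ≤⟨ *-monoˡ-≤ ℓ (m+n≤o⇒m≤o c (many p)) ⟩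
          cnt (adj Γ p) P * ℓ      ∎

        roomy : ∀ A I B J C → P ≡ A ++ I ++ B ++ J ++ C → length I ≤ ℓ → length J ≤ ℓ →
          t + t + 3 ≤ length A + (length B + length C)
        roomy A I B J C P≡ I≤ J≤ = +-cancelʳ-≤ (ℓ + ℓ) _ _ (begin
          t + t + 3 + (ℓ + ℓ)                      ≤⟨ room ⟩
          n                                        ≡⟨ |P| ⟨
          length P                                 ≡⟨ cong length P≡ ⟩
          length (A ++ I ++ B ++ J ++ C)           ≡⟨ split ⟩
          length A + (length I + (length B + (length J + length C)))
            ≡⟨ solve 5 (λ a i b j c → a :+ (i :+ (b :+ (j :+ c))) := a :+ (b :+ c) :+ (i :+ j)) refl
                 (length A) (length I) (length B) (length J) (length C) ⟩
          length A + (length B + length C) + (length I + length J)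
                                                   ≤⟨ +-monoʳ-≤ (length A + (length B + length C)) (+-mono-≤ I≤ J≤) ⟩
          length A + (length B + length C) + (ℓ + ℓ) ∎)
          where
          open +-*-Solver
          split : length (A ++ I ++ B ++ J ++ C) ≡ length A + (length I + (length B + (length J + length C)))
          split rewrite length-++ A {I ++ B ++ J ++ C} | length-++ I {B ++ J ++ C} | length-++ B {J ++ C} | length-++ J {C} = refl

        -- Pigeonhole: if both sides of `I` were too sparse for `q`, the two failures would add up
        -- to a contradiction with `dense`. Each side needs its own allowance `ℓ` for an incomplete
        -- block, hence `ℓ + ℓ` in `dense`; the `ℓ` in `min-degree` pays for neighbours of `q`
        -- inside `I`.
        second-window : ∀ A I C → P ≡ A ++ I ++ C → length I ≤ ℓ →
          ¬ (r * (length A + ℓ) ≤ cnt (adj Γ q) A * ℓ) → r * (length C + ℓ) ≤ cnt (adj Γ q) C * ℓ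
        second-window A I C P≡ I≤ sparse = +-cancelˡ-≤ (cA * ℓ) _ _ (begin
          cA * ℓ + r * (length C + ℓ)                  ≤⟨ +-monoˡ-≤ _ (<⇒≤ (≰⇒> sparse)) ⟩
          r * (length A + ℓ) + r * (length C + ℓ)      ≡⟨ *-distribˡ-+ r (length A + ℓ) _ ⟨
          r * (length A + ℓ + (length C + ℓ))          ≤⟨ *-monoʳ-≤ r AC≤ ⟩
          r * (n + (ℓ + ℓ))                            ≤⟨ dense ⟩
          c * ℓ                                        ≤⟨ *-monoˡ-≤ ℓ c≤ ⟩
          (cA + cC) * ℓ                                ≡⟨ *-distribʳ-+ ℓ cA cC ⟩
          cA * ℓ + cC * ℓ                              ∎)
          where
          cA = cnt (adj Γ q) A
          cI = cnt (adj Γ q) I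
          cC = cnt (adj Γ q) C
          open +-*-Solver
          AC≤ : length A + ℓ + (length C + ℓ) ≤ n + (ℓ + ℓ)
          AC≤ = begin
            length A + ℓ + (length C + ℓ)          ≡⟨ solve 3 (λ a l c → a :+ l :+ (c :+ l) := a :+ c :+ (l :+ l)) refl (length A) ℓ (length C) ⟩
            length A + length C + (ℓ + ℓ)          ≤⟨ +-monoˡ-≤ (ℓ + ℓ) (+-monoʳ-≤ (length A) (m≤n+m (length C) (length I))) ⟩
            length A + (length I + length C) + (ℓ + ℓ)   ≡⟨ cong (λ z → length A + z + (ℓ + ℓ)) (length-++ I) ⟨
            length A + length (I ++ C) + (ℓ + ℓ)   ≡⟨ cong (_+ (ℓ + ℓ)) (length-++ A) ⟨
            length (A ++ I ++ C) + (ℓ + ℓ)         ≡⟨ cong (λ z → length z + (ℓ + ℓ)) P≡ ⟨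
            length P + (ℓ + ℓ)                     ≡⟨ cong (_+ (ℓ + ℓ)) |P| ⟩
            n + (ℓ + ℓ)                            ∎
          c≤ : c ≤ cA + cC
          c≤ = +-cancelʳ-≤ ℓ _ _ (begin
            c + ℓ                              ≤⟨ many q ⟩
            cnt (adj Γ q) P                    ≡⟨ cong (cnt (adj Γ q)) P≡ ⟩
            cnt (adj Γ q) (A ++ I ++ C)        ≡⟨ cnt-++ (adj Γ q) A (I ++ C) ⟩
            cA + cnt (adj Γ q) (I ++ C)        ≡⟨ cong (cA +_) (cnt-++ (adj Γ q) I C) ⟩
            cA + (cI + cC)                     ≡⟨ solve 3 (λ a i c → a :+ (i :+ c) := a :+ c :+ i) refl cA cI cC ⟩
            cA + cC + cI                       ≤⟨ +-monoʳ-≤ (cA + cC) (≤-trans (cnt≤length (adj Γ q) I) I≤) ⟩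
            cA + cC + ℓ                        ∎)

        close₁ : ∀ A I B J C → P ≡ A ++ I ++ B ++ J ++ C → length I ≤ ℓ → length J ≤ ℓ →
          r ≤ cnt (adj Γ p) I → r ≤ cnt (adj Γ q) J → Closing P
        close₁ A I B J C P≡ I≤ J≤ dI dJ = subst Closing (≡.sym P≡)
          (closing₁ expands A I B J C (subst Unique P≡ uP) (subst (Starts p) P≡ sP) (subst (Ends q) P≡ eP) dI dJ
            (roomy A I B J C P≡ I≤ J≤))

        close₂ : ∀ A J B I C → P ≡ A ++ J ++ B ++ I ++ C → length I ≤ ℓ → length J ≤ ℓ →
          r ≤ cnt (adj Γ p) I → r ≤ cnt (adj Γ q) J → Closing P
        close₂ A J B I C P≡ I≤ J≤ dI dJ = subst Closing (≡.sym P≡)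
          (closing₂ expands A J B I C (subst Unique P≡ uP) (subst (Starts p) P≡ sP) (subst (Ends q) P≡ eP) dI dJ
            (roomy A J B I C P≡ J≤ I≤))

        go : Closing P
        go with dense-window (adj Γ p) r ℓ P 0<ℓ hyp₁
        ... | A , I , C , P≡ , I≤ , dI with r * (length A + ℓ) ≤? cnt (adj Γ q) A * ℓ
        ...   | yes h with dense-window (adj Γ q) r ℓ A 0<ℓ h
        ...     | A′ , J , B , refl , J≤ , dJ = close₂ A′ J B I C
                  (≡.trans P≡ (≡.trans (++-assoc A′ (J ++ B) (I ++ C)) (cong (A′ ++_) (++-assoc J B (I ++ C))))) I≤ J≤ dI dJ
        go | A , I , C , P≡ , I≤ , dI | no sparse with dense-window (adj Γ q) r ℓ C 0<ℓ (second-window A I C P≡ I≤ sparse)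
        ...     | B , J , C′ , refl , J≤ , dJ = close₁ A I B J C′ P≡ I≤ J≤ dI dJ

      -- Induction on the bound `k` for the defects. A closed order may be opened at any pair:
      -- cutting it at a defect and gluing the pieces in the order `W ++ U` along the closing edge
      -- `y ~ x` removes that defect and adds none.
      closed-tour : ∀ k P → P ↭ allFin n → bad P ≤ k → ∃ λ P′ → P′ ↭ allFin n × bad P′ ≡ 0 × Closed P′
      closed-tour k P P↭ P≤k with closing P P↭
      closed-tour zero P P↭ P≤0 | P′ , P′↭P , P′≤P , closed =
        P′ , ↭-trans P′↭P P↭ , n≤0⇒n≡0 (≤-trans P′≤P P≤0) , closed
      closed-tour (suc k) P P↭ P≤k | P′ , P′↭P , P′≤P , closed@(x , y , starts xs , yP′ , y~x) with bad P′ ≟ 0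
      ... | yes P′≡0 = P′ , ↭-trans P′↭P P↭ , P′≡0 , closed
      ... | no P′≢0 with cut-defect x xs (n≢0⇒n>0 P′≢0)
      ...   | u , w , U , W , eq , uU , wW , less =
              closed-tour k (W ++ U) (↭-trans (++-comm W U) (↭-trans (↭-reflexive (≡.sym eq)) (↭-trans P′↭P P↭))) (≤-pred (begin-strict
                bad (W ++ U)     ≤⟨ bad-++-≤ W U (ends-++⁻ U wW (subst (Ends y) eq yP′)) (starts-++⁻ U uU (subst (Starts x) eq (starts xs))) y~x ⟩
                bad W + bad U    ≡⟨ +-comm (bad W) _ ⟩
                bad U + bad W    <⟨ less ⟩
                bad P′           ≤⟨ P′≤P ⟩
                bad P            ≤⟨ P≤k ⟩
                suc k            ∎))
              where open ≤-Reasoning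

    lookup-next : ∀ P → bad P ≡ 0 → ∀ i j → toℕ j ≡ suc (toℕ i) → List.lookup P i ~ List.lookup P j
    lookup-next (x ∷ y ∷ zs) P≡0 zero (suc zero) _ with adj Γ x y
    ... | true  = refl
    lookup-next (x ∷ y ∷ zs) P≡0 (suc i) (suc j) j≡ =
      lookup-next (y ∷ zs) (m+n≡0⇒n≡0 (defect x y) P≡0) i j (suc-injective j≡)

    lookup-last : ∀ {y : V} zs i → suc (toℕ i) ≡ length (zs ++ y ∷ []) → List.lookup (zs ++ y ∷ []) i ≡ y
    lookup-last []       zero    _  = refl
    lookup-last (_ ∷ [])    zero ()
    lookup-last (_ ∷ _ ∷ _) zero ()
    lookup-last (z ∷ zs) (suc i) eq = lookup-last zs i (suc-injective eq)

    lookup-ends : ∀ {y : V} P → Ends y P → ∀ i → suc (toℕ i) ≡ length P → List.lookup P i ≡ y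
    lookup-ends P e with ends⇒∷ʳ P e
    ... | zs , refl = lookup-last zs

    lookup-starts : ∀ {x : V} P → Starts x P → ∀ i → toℕ i ≡ 0 → List.lookup P i ≡ x
    lookup-starts _ (starts _) zero _ = refl

    tour⇒hamilton : ∀ P → P ↭ allFin n → bad P ≡ 0 → Closed P → HamiltonCycle Γ
    tour⇒hamilton P P↭ P≡0 (x , y , xP , yP , y~x) = σ , edge
      where
      |P| : n ≡ length P
      |P| = ≡.sym (≡.trans (↭-length P↭) (length-tabulate (λ i → i)))
      |allFin| : length (allFin n) ≡ n
      |allFin| = length-tabulate (λ i → i)
      -- `onIndices` extracts the bijection of positions from `P ↭ allFin n`. Since `allFin n`
      -- carries each vertex at its own index, `σ` sends `i` to the entry of `P` at position `i`.
      π : Permutation (length P) (length (allFin n))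
      π = onIndices (↭⇒↭ₛ P↭)
      σ : Permutation′ n
      σ = cast-id |P| ∘ₚ π ∘ₚ cast-id |allFin|
      at : Fin n → Fin (length P)
      at = Fin.cast |P|
      σ≡ : ∀ i → σ ⟨$⟩ʳ i ≡ List.lookup P (at i)
      σ≡ i = begin
        Fin.cast |allFin| j                                       ≡⟨ lookup-tabulate (λ i → i) (Fin.cast |allFin| j) ⟨
        List.lookup (allFin n) (Fin.cast (≡.sym |allFin|) (Fin.cast |allFin| j))        ≡⟨ cong (List.lookup (allFin n)) (cast-involutive (≡.sym |allFin|) |allFin| j) ⟩
        List.lookup (allFin n) j                                  ≡⟨ ↭ₛ.onIndices-lookup (setoid V) (↭⇒↭ₛ P↭) (at i) ⟨
        List.lookup P (at i)                                      ∎
        where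
        open ≡.≡-Reasoning
        j = π ⟨$⟩ʳ at i
      edge : ∀ i → σ ⟨$⟩ʳ i ~ σ ⟨$⟩ʳ next i
      edge i = ≡.subst₂ _~_ (≡.sym (σ≡ i)) (≡.sym (σ≡ (next i))) (lookup-edge (next-cases i))
        where
        lookup-edge : toℕ (next i) ≡ suc (toℕ i) ⊎ (suc (toℕ i) ≡ n × toℕ (next i) ≡ 0) →
          List.lookup P (at i) ~ List.lookup P (at (next i))
        lookup-edge (inj₁ eq) = lookup-next P P≡0 (at i) (at (next i))
          (≡.trans (toℕ-cast |P| (next i)) (≡.trans eq (cong suc (≡.sym (toℕ-cast |P| i)))))
        lookup-edge (inj₂ (last , first)) = ≡.subst₂ _~_
          (≡.sym (lookup-ends P yP (at i) (≡.trans (cong suc (toℕ-cast |P| i)) (≡.trans last |P|))))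
          (≡.sym (lookup-starts P xP (at (next i)) (≡.trans (toℕ-cast |P| (next i)) first))) y~x

    hamilton-cycle : ∀ {s t ℓ c} → Expands s t → 0 < ℓ → (∀ v → c + ℓ ≤ degree Γ v) →
      suc s * (n + (ℓ + ℓ)) ≤ c * ℓ → t + t + 3 + (ℓ + ℓ) ≤ n → HamiltonCycle Γ
    hamilton-cycle expands 0<ℓ min-degree dense room
      with closed-tour expands 0<ℓ min-degree dense room (bad (allFin n)) (allFin n) ↭-refl ≤-refl
    ... | P , P↭ , P≡0 , closed = tour⇒hamilton P P↭ P≡0 closed

-- Rational arithmetic: naturals, ceilings and nonnegativity certificates

open Combinatorics
open Hamiltonicity using (hamilton-cycle)
open import Data.Integer using (+_)
import Data.Integer as ℤ
import Data.Integer.Properties as ℤ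
open import Data.Rational as ℚ using (ℚ; mkℚ; _/_; _-_; _+_; _*_; _≤_; _<_; _>_; 0ℚ; ½; 1ℚ; toℚᵘ; NonNegative; nonNegative; positive)
import Data.Rational.Properties as ℚ
import Data.Rational.Solver as ℚ
open import Data.Rational.Unnormalised as ℚᵘ using (mkℚᵘ; *≡*; *≤*)
import Data.Rational.Unnormalised.Properties as ℚᵘ

ℕ→ℚᵘ : ℕ → ℚᵘ.ℚᵘ
ℕ→ℚᵘ n = mkℚᵘ (+ n) 0

toℚᵘ-ℕ→ℚ : ∀ n → toℚᵘ (ℕ→ℚ n) ℚᵘ.≃ ℕ→ℚᵘ n
toℚᵘ-ℕ→ℚ n = ℚ.toℚᵘ-fromℚᵘ (ℕ→ℚᵘ n)

ℕ→ℚ-+ : ∀ a b → ℕ→ℚ (a ℕ.+ b) ≡ ℕ→ℚ a + ℕ→ℚ b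
ℕ→ℚ-+ a b = ℚ.toℚᵘ-injective (begin
  toℚᵘ (ℕ→ℚ (a ℕ.+ b))                 ≈⟨ toℚᵘ-ℕ→ℚ (a ℕ.+ b) ⟩
  ℕ→ℚᵘ (a ℕ.+ b)                       ≈⟨ *≡* (cong (ℤ._* + 1) (≡.trans (ℤ.pos-+ a b) (≡.sym (cong₂ ℤ._+_ (ℤ.*-identityʳ (+ a)) (ℤ.*-identityʳ (+ b)))))) ⟩
  ℕ→ℚᵘ a ℚᵘ.+ ℕ→ℚᵘ b                   ≈⟨ ℚᵘ.+-cong (toℚᵘ-ℕ→ℚ a) (toℚᵘ-ℕ→ℚ b) ⟨
  toℚᵘ (ℕ→ℚ a) ℚᵘ.+ toℚᵘ (ℕ→ℚ b)       ≈⟨ ℚ.toℚᵘ-homo-+ (ℕ→ℚ a) (ℕ→ℚ b) ⟨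
  toℚᵘ (ℕ→ℚ a + ℕ→ℚ b)                 ∎)
  where open ℚᵘ.≃-Reasoning

ℕ→ℚ-* : ∀ a b → ℕ→ℚ (a ℕ.* b) ≡ ℕ→ℚ a * ℕ→ℚ b
ℕ→ℚ-* a b = ℚ.toℚᵘ-injective (begin
  toℚᵘ (ℕ→ℚ (a ℕ.* b))                 ≈⟨ toℚᵘ-ℕ→ℚ (a ℕ.* b) ⟩
  ℕ→ℚᵘ (a ℕ.* b)                       ≈⟨ *≡* (cong (ℤ._* + 1) (ℤ.pos-* a b)) ⟩
  ℕ→ℚᵘ a ℚᵘ.* ℕ→ℚᵘ b                   ≈⟨ ℚᵘ.*-cong (toℚᵘ-ℕ→ℚ a) (toℚᵘ-ℕ→ℚ b) ⟨
  toℚᵘ (ℕ→ℚ a) ℚᵘ.* toℚᵘ (ℕ→ℚ b)       ≈⟨ ℚ.toℚᵘ-homo-* (ℕ→ℚ a) (ℕ→ℚ b) ⟨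
  toℚᵘ (ℕ→ℚ a * ℕ→ℚ b)                 ∎)
  where open ℚᵘ.≃-Reasoning

ℕ→ℚ-mono-≤ : ∀ {a b} → a ℕ.≤ b → ℕ→ℚ a ≤ ℕ→ℚ b
ℕ→ℚ-mono-≤ {a} {b} a≤b = ℚ.toℚᵘ-cancel-≤ (ℚᵘ.≤-respˡ-≃ (ℚᵘ.≃-sym (toℚᵘ-ℕ→ℚ a))
  (ℚᵘ.≤-respʳ-≃ (ℚᵘ.≃-sym (toℚᵘ-ℕ→ℚ b)) (*≤* (ℤ.*-monoʳ-≤-nonNeg (+ 1) (ℤ.+≤+ a≤b)))))

ℕ→ℚ-cancel-≤ : ∀ {a b} → ℕ→ℚ a ≤ ℕ→ℚ b → a ℕ.≤ b
ℕ→ℚ-cancel-≤ {a} {b} le with ℚᵘ.≤-respˡ-≃ (toℚᵘ-ℕ→ℚ a) (ℚᵘ.≤-respʳ-≃ (toℚᵘ-ℕ→ℚ b) (ℚ.toℚᵘ-mono-≤ le))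
... | *≤* a*1≤b*1 = ℤ.drop‿+≤+ (ℤ.*-cancelʳ-≤-pos (+ a) (+ b) (+ 1) a*1≤b*1)

-- The absolute value of the numerator is large enough, because the denominator is at least 1.
archimedean : ∀ x → ∃ λ k → x ≤ ℕ→ℚ k
archimedean x@(mkℚ p q _) = ℤ.∣ p ∣ , ℚ.toℚᵘ-cancel-≤ (ℚᵘ.≤-respʳ-≃ (ℚᵘ.≃-sym (toℚᵘ-ℕ→ℚ ℤ.∣ p ∣)) (*≤* bound))
  where
  open ℤ.≤-Reasoning
  bound : p ℤ.* + 1 ℤ.≤ + ℤ.∣ p ∣ ℤ.* + (suc q)
  bound = begin
    p ℤ.* + 1                   ≡⟨ ℤ.*-identityʳ p ⟩
    p                           ≤⟨ i≤∣i∣ p ⟩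
    + ℤ.∣ p ∣                   ≤⟨ ℤ.+≤+ (ℕ.m≤m*n ℤ.∣ p ∣ (suc q)) ⟩
    + (ℤ.∣ p ∣ ℕ.* suc q)       ≡⟨ ℤ.pos-* ℤ.∣ p ∣ (suc q) ⟩
    + ℤ.∣ p ∣ ℤ.* + (suc q)     ∎
    where
    i≤∣i∣ : ∀ i → i ℤ.≤ + ℤ.∣ i ∣
    i≤∣i∣ (+ n)        = ℤ.≤-refl
    i≤∣i∣ (ℤ.-[1+ n ]) = ℤ.-≤+

Ceiling : ℚ → Set
Ceiling x = ∃ λ k → x ≤ ℕ→ℚ k × ℕ→ℚ k ≤ x + 1ℚ

-- Descends from an Archimedean bound until one more step would fall below `x`. If the descent
-- reaches 0, the upper bound comes from `0≤x`.
ceil : ∀ x → 0ℚ ≤ x → Ceiling x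
ceil x 0≤x with archimedean x
... | k , x≤k = search k x≤k
  where
  search : ∀ k → x ≤ ℕ→ℚ k → Ceiling x
  search zero    x≤0 = 0 , x≤0 , ℚ.+-mono-≤ 0≤x (ℚ.nonNegative⁻¹ 1ℚ)
  search (suc k) x≤k+1 with x ℚ.≤? ℕ→ℚ k
  ... | yes x≤k = search k x≤k
  ... | no  x≰k = suc k , x≤k+1 , (begin
    ℕ→ℚ (suc k)         ≡⟨ ℕ→ℚ-+ 1 k ⟩
    1ℚ + ℕ→ℚ k          ≡⟨ ℚ.+-comm 1ℚ (ℕ→ℚ k) ⟩
    ℕ→ℚ k + 1ℚ          ≤⟨ ℚ.+-monoˡ-≤ 1ℚ (ℚ.<⇒≤ (ℚ.≰⇒> x≰k)) ⟩
    x + 1ℚ              ∎)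
    where open ℚ.≤-Reasoning

-- The format of the estimates below: the difference of the two sides is exhibited as a combination
-- of nonnegative terms, built with `gap`, `⊕` and `⊗` from the hypotheses, and the ring solver
-- checks the identity.
by-gap : ∀ {p q r} → 0ℚ ≤ r → p + r ≡ q → p ≤ q
by-gap {p} 0≤r refl = ℚ.≤-trans (ℚ.≤-reflexive (≡.sym (ℚ.+-identityʳ p))) (ℚ.+-monoʳ-≤ p 0≤r)

gap : ∀ {p q} → p ≤ q → 0ℚ ≤ q - p
gap {p} p≤q = ℚ.≤-trans (ℚ.≤-reflexive (≡.sym (ℚ.+-inverseʳ p))) (ℚ.+-monoˡ-≤ (ℚ.- p) p≤q)

infixl 6 _⊕_
infixl 7 _⊗_
_⊕_ : ∀ {p q} → 0ℚ ≤ p → 0ℚ ≤ q → 0ℚ ≤ p + q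
_⊕_ = ℚ.+-mono-≤

_⊗_ : ∀ {p q} → 0ℚ ≤ p → 0ℚ ≤ q → 0ℚ ≤ p * q
_⊗_ {p} {q} 0≤p 0≤q = ℚ.nonNegative⁻¹ (p * q) {{ℚ.nonNeg*nonNeg⇒nonNeg p {{nonNegative 0≤p}} q {{nonNegative 0≤q}}}}

0≤const : ∀ q {{_ : NonNegative q}} → 0ℚ ≤ q
0≤const q = ℚ.nonNegative⁻¹ q

-- From `y ≥ d x − |y − d x| ≥ (d − ε) x`. The variable `x` is separate from `a * b` because
-- regularity speaks of a product formed in the naturals.
abs-lower-bound : ∀ a b x y d ε → x ≡ a * b → ℚ.∣ y - d * x ∣ ≤ ε * x → a * ((d - ε) * b) ≤ y
abs-lower-bound a b _ y d ε refl near = by-gap (0≤p+∣p∣ (y - d * (a * b)) ⊕ gap near)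
  (solve 6 (λ a b d ε y m → a :* ((d :- ε) :* b) :+ (((y :- d :* (a :* b)) :+ m) :+ (ε :* (a :* b) :- m)) := y) refl
    a b d ε y ℚ.∣ y - d * (a * b) ∣)
  where
  open ℚ.+-*-Solver
  0≤p+∣p∣ : ∀ p → 0ℚ ≤ p + ℚ.∣ p ∣
  0≤p+∣p∣ p with ℚ.∣p∣≡p∨∣p∣≡-p p
  ... | inj₁ eq = ℚ.∣p∣≡p⇒0≤p eq ⊕ ℚ.0≤∣p∣ p
  ... | inj₂ eq = ℚ.≤-reflexive (≡.sym (≡.trans (cong (λ z → p + z) eq) (ℚ.+-inverseʳ p)))

-- Numerical estimates, with `e` in the role of ε/d

module Estimates {d e n : ℚ} (0≤d : 0ℚ ≤ d) (0≤e : 0ℚ ≤ e) (0≤n : 0ℚ ≤ n)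
  (d≤1 : d ≤ 1ℚ) (e≤1/32 : e ≤ + 1 / 32) (8≤den : + 8 / 1 ≤ d * e * n) where

  open ℚ.+-*-Solver

  8≤en : + 8 / 1 ≤ e * n
  8≤en = by-gap (gap 8≤den ⊕ gap d≤1 ⊗ (0≤e ⊗ 0≤n))
    (solve 3 (λ d e n → con (+ 8 / 1) :+ ((d :* e :* n :- con (+ 8 / 1)) :+ (con 1ℚ :- d) :* (e :* n)) := e :* n) refl d e n)

  8≤n : + 8 / 1 ≤ n
  8≤n = by-gap (gap 8≤en ⊕ gap e≤1/32 ⊗ 0≤n ⊕ 0≤const (+ 31 / 32) ⊗ 0≤n)
    (solve 2 (λ e n → con (+ 8 / 1) :+ ((e :* n :- con (+ 8 / 1)) :+ (con (+ 1 / 32) :- e) :* n :+ con (+ 31 / 32) :* n) := n) refl e n)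

  -- The right side exceeds the unrounded sum by `4 e n`, which is at least 32, while the two
  -- roundings cost 2.
  degree-bound : ∀ {C L} → C ≤ d * ½ * n + 1ℚ → L ≤ + 4 / 1 * e * n + 1ℚ → C + L ≤ (d * ½ + + 8 / 1 * e) * n
  degree-bound {C} {L} C≤ L≤ = by-gap (gap C≤ ⊕ gap L≤ ⊕ 0≤const (+ 4 / 1) ⊗ gap 8≤en ⊕ 0≤const (+ 30 / 1))
    (solve 5 (λ d e n C L → C :+ L :+ ((d :* con ½ :* n :+ con 1ℚ :- C) :+ (con (+ 4 / 1) :* e :* n :+ con 1ℚ :- L) :+ con (+ 4 / 1) :* (e :* n :- con (+ 8 / 1)) :+ con (+ 30 / 1))
       := (d :* con ½ :+ con (+ 8 / 1) :* e) :* n) refl d e n C L)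

  -- By `8≤den` the factor `1 + S` is at most `5/4 d e n`, and by `e≤1/32` and `8≤n` the other
  -- factor is at most `3/2 n`. Their product `15/8 d e n n` is below the lower bound `2 d e n n`
  -- for `C * L`; the difference is the term with `1/8`.
  density-bound : ∀ {C L S} → 0ℚ ≤ L → 0ℚ ≤ S → d * ½ * n ≤ C → + 4 / 1 * e * n ≤ L → L ≤ + 4 / 1 * e * n + 1ℚ →
    S ≤ d * e * n + 1ℚ → (1ℚ + S) * (n + (L + L)) ≤ C * L
  density-bound {C} {L} {S} 0≤L 0≤S C≥ L≥ L≤ S≤ = by-gap
    (gap C≥ ⊗ 0≤L ⊕ 0≤d ⊗ 0≤const ½ ⊗ 0≤n ⊗ gap L≥ ⊕ 0≤const (+ 1 / 8) ⊗ 0≤d ⊗ 0≤e ⊗ 0≤n ⊗ 0≤n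
      ⊕ (gap S≤ ⊕ 0≤const (+ 1 / 4) ⊗ gap 8≤den) ⊗ (0≤const (+ 3 / 2) ⊗ 0≤n)
      ⊕ (0≤const 1ℚ ⊕ 0≤S) ⊗ (0≤const (+ 2 / 1) ⊗ gap L≤ ⊕ 0≤const (+ 8 / 1) ⊗ gap e≤1/32 ⊗ 0≤n ⊕ 0≤const (+ 1 / 4) ⊗ gap 8≤n))
    (solve 6 (λ d e n C L S → (con 1ℚ :+ S) :* (n :+ (L :+ L)) :+
        ((C :- d :* con ½ :* n) :* L :+ d :* con ½ :* n :* (L :- con (+ 4 / 1) :* e :* n) :+ con (+ 1 / 8) :* d :* e :* n :* n
          :+ ((d :* e :* n :+ con 1ℚ :- S) :+ con (+ 1 / 4) :* (d :* e :* n :- con (+ 8 / 1))) :* (con (+ 3 / 2) :* n)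
          :+ (con 1ℚ :+ S) :* (con (+ 2 / 1) :* (con (+ 4 / 1) :* e :* n :+ con 1ℚ :- L) :+ con (+ 8 / 1) :* (con (+ 1 / 32) :- e) :* n :+ con (+ 1 / 4) :* (n :- con (+ 8 / 1))))
      := C :* L) refl d e n C L S)

  -- Two copies of `T` leave `12 e n` free and the two windows take `8 e n` of it. The remaining
  -- `4 e n`, at least 32, covers the constant 3 and the rounding loss of 4.
  room-bound : ∀ {T L} → T ≤ (½ - + 6 / 1 * e) * n + 1ℚ → L ≤ + 4 / 1 * e * n + 1ℚ → T + T + + 3 / 1 + (L + L) ≤ n
  room-bound {T} {L} T≤ L≤ = by-gap
    (0≤const (+ 2 / 1) ⊗ gap T≤ ⊕ 0≤const (+ 2 / 1) ⊗ gap L≤ ⊕ 0≤const (+ 4 / 1) ⊗ gap 8≤en ⊕ 0≤const (+ 25 / 1))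
    (solve 4 (λ e n T L → T :+ T :+ con (+ 3 / 1) :+ (L :+ L) :+
        (con (+ 2 / 1) :* ((con ½ :- con (+ 6 / 1) :* e) :* n :+ con 1ℚ :- T) :+ con (+ 2 / 1) :* (con (+ 4 / 1) :* e :* n :+ con 1ℚ :- L)
          :+ con (+ 4 / 1) :* (e :* n :- con (+ 8 / 1)) :+ con (+ 25 / 1))
      := n) refl e n T L)

  0≤d-de : 0ℚ ≤ d - d * e
  0≤d-de = by-gap (0≤d ⊗ (gap e≤1/32 ⊕ 0≤const (+ 31 / 32)))
    (solve 2 (λ d e → con 0ℚ :+ d :* ((con (+ 1 / 32) :- e) :+ con (+ 31 / 32)) := d :- d :* e) refl d e)

  0≤½-6e : 0ℚ ≤ ½ - + 6 / 1 * e
  0≤½-6e = by-gap (0≤const (+ 6 / 1) ⊗ gap e≤1/32 ⊕ 0≤const (+ 10 / 32))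
    (solve 1 (λ e → con 0ℚ :+ (con (+ 6 / 1) :* (con (+ 1 / 32) :- e) :+ con (+ 10 / 32)) := con ½ :- con (+ 6 / 1) :* e) refl e)

  -- After inserting the lower bound for `T`, the sides differ by `(8 − 13/2 d) e n + 6 d e e n`.
  -- Since `d ≤ 1` this is at least `3/2 e n`, hence at least 12, and so the inequality is strict.
  expansion-bound : ∀ {T} → (½ - + 6 / 1 * e) * n ≤ T → (d * ½ - + 8 / 1 * e) * n < (d - d * e) * T
  expansion-bound {T} T≥ = ℚ.<-≤-trans
    (ℚ.≤-<-trans (ℚ.≤-reflexive (≡.sym (ℚ.+-identityʳ _))) (ℚ.+-monoʳ-< ((d * ½ - + 8 / 1 * e) * n) (ℚ.positive⁻¹ (+ 12 / 1))))
    (by-gap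
      (0≤d-de ⊗ gap T≥ ⊕ 0≤const (+ 13 / 2) ⊗ gap d≤1 ⊗ (0≤e ⊗ 0≤n) ⊕ 0≤const (+ 6 / 1) ⊗ 0≤d ⊗ 0≤e ⊗ (0≤e ⊗ 0≤n) ⊕ 0≤const (+ 3 / 2) ⊗ gap 8≤en)
      (solve 4 (λ d e n T → (d :* con ½ :- con (+ 8 / 1) :* e) :* n :+ con (+ 12 / 1) :+
          ((d :- d :* e) :* (T :- (con ½ :- con (+ 6 / 1) :* e) :* n) :+ con (+ 13 / 2) :* (con 1ℚ :- d) :* (e :* n)
            :+ con (+ 6 / 1) :* d :* e :* (e :* n) :+ con (+ 3 / 2) :* (e :* n :- con (+ 8 / 1)))
        := (d :- d :* e) :* T) refl d e n T))

  -- Makes regularity applicable to sets of size `t`; it holds because `d e ≤ e` and `7 e ≤ 1/2`.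
  size-bound : ∀ {T} → (½ - + 6 / 1 * e) * n ≤ T → d * e * n ≤ T
  size-bound {T} T≥ = by-gap
    (gap T≥ ⊕ 0≤const (+ 16 / 1) ⊗ gap e≤1/32 ⊗ 0≤n ⊕ 0≤const (+ 9 / 1) ⊗ (0≤e ⊗ 0≤n) ⊕ gap d≤1 ⊗ (0≤e ⊗ 0≤n))
    (solve 4 (λ d e n T → d :* e :* n :+
        ((T :- (con ½ :- con (+ 6 / 1) :* e) :* n) :+ con (+ 16 / 1) :* (con (+ 1 / 32) :- e) :* n :+ con (+ 9 / 1) :* (e :* n) :+ (con 1ℚ :- d) :* (e :* n))
      := T) refl d e n T)

  residual-degree-bound : ∀ {x y z} → d * n ≤ x → y ≤ (d * ½ - + 8 / 1 * e) * n → x ≤ z + y → (d * ½ + + 8 / 1 * e) * n ≤ z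
  residual-degree-bound {x} {y} {z} x≥ y≤ x≤ = by-gap (gap x≥ ⊕ gap y≤ ⊕ gap x≤)
    (solve 6 (λ d e n x y z → (d :* con ½ :+ con (+ 8 / 1) :* e) :* n :+
        ((x :- d :* n) :+ ((d :* con ½ :- con (+ 8 / 1) :* e) :* n :- y) :+ (z :+ y :- x))
      := z) refl d e n x y z)

  1≤4en : 1ℚ ≤ + 4 / 1 * e * n
  1≤4en = by-gap (0≤const (+ 4 / 1) ⊗ gap 8≤en ⊕ 0≤const (+ 31 / 1))
    (solve 2 (λ e n → con 1ℚ :+ (con (+ 4 / 1) :* (e :* n :- con (+ 8 / 1)) :+ con (+ 31 / 1)) := con (+ 4 / 1) :* e :* n) refl e n)

-- Counting edges between sets, and expansion of the graph without `H`

cnt-≤-+ : ∀ {A : Set} (f g h : A → Bool) → (∀ v → f v ≡ true → g v ≡ true ⊎ h v ≡ true) →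
  ∀ xs → cnt f xs ℕ.≤ cnt g xs ℕ.+ cnt h xs
cnt-≤-+ f g h f⇒ []       = z≤n
cnt-≤-+ f g h f⇒ (x ∷ xs) = begin
  [ f x ] ℕ.+ cnt f xs                              ≤⟨ ℕ.+-mono-≤ (one (f x) (g x) (h x) (f⇒ x)) (cnt-≤-+ f g h f⇒ xs) ⟩
  [ g x ] ℕ.+ [ h x ] ℕ.+ (cnt g xs ℕ.+ cnt h xs)   ≡⟨ solve 4 (λ a b c d → a :+ b :+ (c :+ d) := a :+ c :+ (b :+ d)) refl [ g x ] [ h x ] (cnt g xs) (cnt h xs) ⟩
  [ g x ] ℕ.+ cnt g xs ℕ.+ ([ h x ] ℕ.+ cnt h xs)   ∎
  where
  open ℕ.≤-Reasoning
  open ℕ.+-*-Solver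
  [_] : Bool → ℕ
  [ b ] = if b then 1 else 0
  one : ∀ a b c → (a ≡ true → b ≡ true ⊎ c ≡ true) → [ a ] ℕ.≤ [ b ] ℕ.+ [ c ]
  one false _     _ _ = z≤n
  one true  true  _ _ = s≤s z≤n
  one true  false c h with h refl
  ... | inj₂ refl = s≤s z≤n

cnt-false : ∀ {A : Set} (xs : List A) → cnt (λ _ → false) xs ≡ 0
cnt-false []       = refl
cnt-false (x ∷ xs) = cnt-false xs

cnt-mono : ∀ {A : Set} (f g : A → Bool) → (∀ v → f v ≡ true → g v ≡ true) → ∀ xs → cnt f xs ℕ.≤ cnt g xs
cnt-mono f g f⇒g xs = ℕ.≤-trans (cnt-≤-+ f g (λ _ → false) (λ v → inj₁ ∘ f⇒g v) xs)
  (ℕ.≤-reflexive (≡.trans (cong (cnt g xs ℕ.+_) (cnt-false xs)) (ℕ.+-identityʳ _)))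

cnt-lookup : ∀ {n} (S : Subset n) → cnt (lookup S) (allFin n) ≡ ∣ S ∣
cnt-lookup []      = refl
cnt-lookup {suc n} (b ∷ S) = ≡.trans (cong ((if b then 1 else 0) ℕ.+_) shift) (head b)
  where
  shift : cnt (lookup (b ∷ S)) (tabulate suc) ≡ ∣ S ∣
  shift = ≡.trans (cong sum (≡.trans (map-tabulate {n = n} suc (λ i → if lookup (b ∷ S) i then 1 else 0))
    (≡.sym (map-tabulate {n = n} (λ i → i) (λ i → if lookup S i then 1 else 0))))) (cnt-lookup S)
  head : ∀ b → (if b then 1 else 0) ℕ.+ ∣ S ∣ ≡ ∣ b ∷ S ∣
  head true  = refl
  head false = refl

⟦_⟧ : ∀ {n} → List (Fin n) → Subset n
⟦ [] ⟧     = ⊥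
⟦ x ∷ xs ⟧ = ⟦ xs ⟧ [ x ]≔ true

∈⟦⟧⁻ : ∀ {n} (xs : List (Fin n)) v → lookup ⟦ xs ⟧ v ≡ true → v ∈ xs
∈⟦⟧⁻ []       v eq = contradiction (≡.trans (≡.sym (lookup-replicate v false)) eq) λ ()
∈⟦⟧⁻ (x ∷ xs) v eq with v Fin.≟ x
... | yes v≡x = here v≡x
... | no  v≢x = there (∈⟦⟧⁻ xs v (≡.trans (≡.sym (lookup∘update′ v≢x ⟦ xs ⟧ true)) eq))

∣update∣ : ∀ {n} (S : Subset n) x → lookup S x ≡ false → ∣ S [ x ]≔ true ∣ ≡ suc ∣ S ∣
∣update∣ (.false ∷ S) zero    refl = refl
∣update∣ (true   ∷ S) (suc x) eq   = cong suc (∣update∣ S x eq)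
∣update∣ (false  ∷ S) (suc x) eq   = ∣update∣ S x eq

∣⟦⟧∣ : ∀ {n} {xs : List (Fin n)} → Unique xs → ∣ ⟦ xs ⟧ ∣ ≡ length xs
∣⟦⟧∣ {n} [] = ∣⊥∣≡0 n
  where open import Data.Fin.Subset.Properties using (∣⊥∣≡0)
∣⟦⟧∣ {xs = x ∷ xs} (x∉ ∷ u) = ≡.trans (∣update∣ ⟦ xs ⟧ x (Bool.¬-not x∉⟦⟧)) (cong suc (∣⟦⟧∣ u))
  where
  x∉⟦⟧ : lookup ⟦ xs ⟧ x ≢ true
  x∉⟦⟧ eq = All.lookup x∉ (∈⟦⟧⁻ xs x eq) refl

sum-≤-scaled : ∀ {A : Set} (f g : A → ℕ) Δ → (∀ u → ℕ→ℚ (f u) ≤ ℕ→ℚ (g u) * Δ) →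
  ∀ us → ℕ→ℚ (sum (map f us)) ≤ ℕ→ℚ (sum (map g us)) * Δ
sum-≤-scaled f g Δ f≤g []       = ℚ.≤-reflexive (≡.sym (ℚ.*-zeroˡ Δ))
sum-≤-scaled f g Δ f≤g (u ∷ us) = begin
  ℕ→ℚ (f u ℕ.+ sum (map f us))                          ≡⟨ ℕ→ℚ-+ (f u) _ ⟩
  ℕ→ℚ (f u) + ℕ→ℚ (sum (map f us))                      ≤⟨ ℚ.+-mono-≤ (f≤g u) (sum-≤-scaled f g Δ f≤g us) ⟩
  ℕ→ℚ (g u) * Δ + ℕ→ℚ (sum (map g us)) * Δ              ≡⟨ ℚ.*-distribʳ-+ Δ (ℕ→ℚ (g u)) _ ⟨
  (ℕ→ℚ (g u) + ℕ→ℚ (sum (map g us))) * Δ                ≡⟨ cong (_* Δ) (ℕ→ℚ-+ (g u) _) ⟨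
  ℕ→ℚ (g u ℕ.+ sum (map g us)) * Δ                      ∎
  where open ℚ.≤-Reasoning

module _ {n : ℕ} (G H : Graph n) where

  degree-⊖ : ∀ v → degree G v ℕ.≤ degree (G ⊖ H) v ℕ.+ degree H v
  degree-⊖ v = cnt-≤-+ (adj G v) (adj (G ⊖ H) v) (adj H v) split (allFin n)
    where
    split : ∀ u → adj G v u ≡ true → adj (G ⊖ H) v u ≡ true ⊎ adj H v u ≡ true
    split u vu with adj H v u
    ... | true  = inj₂ refl
    ... | false rewrite vu = inj₁ refl

  -- If no edge of `G ⊖ H` joins `S` to `T`, all edges of `G` between them belong to `H`, so each
  -- vertex of `S` accounts for at most `Δ` of them.
  eST-≤ : ∀ S T {Δ} → MaxDegree≤ H Δ →
    (∀ u v → lookup S u ≡ true → lookup T v ≡ true → adj (G ⊖ H) u v ≢ true) →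
    ℕ→ℚ (eST G S T) ≤ ℕ→ℚ ∣ S ∣ * Δ
  eST-≤ S T {Δ} maxdeg none = ℚ.≤-trans (sum-≤-scaled row (λ u → if lookup S u then 1 else 0) Δ row≤ (allFin n))
    (ℚ.≤-reflexive (cong (λ k → ℕ→ℚ k * Δ) (cnt-lookup S)))
    where
    row : Fin n → ℕ
    row u = count (λ v → lookup S u ∧ (lookup T v ∧ adj G u v))
    row≤ : ∀ u → ℕ→ℚ (row u) ≤ ℕ→ℚ (if lookup S u then 1 else 0) * Δ
    row≤ u with lookup S u in u∈S
    ... | false = ℚ.≤-reflexive (≡.trans (cong ℕ→ℚ (cnt-false (allFin n))) (≡.sym (ℚ.*-zeroˡ Δ)))
    ... | true  = ℚ.≤-trans (ℕ→ℚ-mono-≤ (cnt-mono _ (adj H u) inH (allFin n)))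
                    (ℚ.≤-trans (maxdeg u) (ℚ.≤-reflexive (≡.sym (ℚ.*-identityˡ Δ))))
      where
      inH : ∀ v → lookup T v ∧ adj G u v ≡ true → adj H u v ≡ true
      inH v eq with lookup T v in v∈T | adj G u v in uv | adj H u v in uvH
      ... | true | true | true  = refl
      ... | true | true | false = contradiction (cong₂ (λ a b → a ∧ not b) uv uvH) (none u v u∈S v∈T)

  open Tours (G ⊖ H) using (Expands)

  module _ {d ε Δ : ℚ} (regular : Regular d ε G) (maxdeg : MaxDegree≤ H Δ) (0≤d-ε : 0ℚ ≤ d - ε) where

    eST-≥ : ∀ S T → Disjoint S T → ε * ℕ→ℚ n ≤ ℕ→ℚ ∣ S ∣ → ε * ℕ→ℚ n ≤ ℕ→ℚ ∣ T ∣ →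
      ℕ→ℚ ∣ S ∣ * ((d - ε) * ℕ→ℚ ∣ T ∣) ≤ ℕ→ℚ (eST G S T)
    eST-≥ S T disjoint S≥ T≥ =
      abs-lower-bound (ℕ→ℚ ∣ S ∣) (ℕ→ℚ ∣ T ∣) (ℕ→ℚ (∣ S ∣ ℕ.* ∣ T ∣)) (ℕ→ℚ (eST G S T)) d ε (ℕ→ℚ-* ∣ S ∣ ∣ T ∣) (proj₂ regular S T disjoint S≥ T≥)

    -- If there were no edge between the sets, regularity and `eST-≤` would give
    -- `(d − ε) |S| |T| ≤ |S| Δ`. This contradicts `Δ < (d − ε) t`, as `|T|` is at least `t` and
    -- `0 < s` makes `|S|` positive.
    regular⇒expands : ∀ {s t} → 0 ℕ.< s → ε * ℕ→ℚ n ≤ ℕ→ℚ s → ε * ℕ→ℚ n ≤ ℕ→ℚ t →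
      Δ < (d - ε) * ℕ→ℚ t → Expands s t
    regular⇒expands {s} {t} 0<s s≥ t≥ Δ< xs ts unique s≤xs t≤ts
      = decide (any? (λ x → any? (λ y → adj (G ⊖ H) x y Bool.≟ true) ts) xs)
      where
      Hit : Set
      Hit = Any (λ x → Any (λ y → adj (G ⊖ H) x y ≡ true) ts) xs
      S = ⟦ xs ⟧
      T = ⟦ ts ⟧
      |S| : ∣ S ∣ ≡ length xs
      |S| = ∣⟦⟧∣ (unique-⊆ (Sub.++⁺ʳ ts ⊆-refl) unique)
      |T| : ∣ T ∣ ≡ length ts
      |T| = ∣⟦⟧∣ (unique-⊆ (Sub.++⁺ˡ xs ⊆-refl) unique)
      s≤S : s ℕ.≤ ∣ S ∣
      s≤S = ℕ.≤-trans s≤xs (ℕ.≤-reflexive (≡.sym |S|))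
      t≤T : ℕ→ℚ t ≤ ℕ→ℚ ∣ T ∣
      t≤T = ℕ→ℚ-mono-≤ (ℕ.≤-trans t≤ts (ℕ.≤-reflexive (≡.sym |T|)))
      apart : ∀ xs → Unique (xs ++ ts) → ∀ {v} → v ∈ xs → ¬ (v ∈ ts)
      apart (x ∷ xs) (x∉ ∷ _) (here refl) v∈ts = All.lookup x∉ (∈-++⁺ʳ xs v∈ts) refl
      apart (x ∷ xs) (_ ∷ u)  (there v∈)  v∈ts = apart xs u v∈ v∈ts
      disjoint : Disjoint S T
      disjoint v (v∈S , v∈T) = apart xs unique (∈⟦⟧⁻ xs v ([]=⇒lookup v∈S)) (∈⟦⟧⁻ ts v ([]=⇒lookup v∈T))
      none : ¬ Hit → ∀ u v → lookup S u ≡ true → lookup T v ≡ true → adj (G ⊖ H) u v ≢ true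
      none miss u v u∈S v∈T uv = miss (lose (∈⟦⟧⁻ xs u u∈S) (lose (∈⟦⟧⁻ ts v v∈T) uv))
      lower = eST-≥ S T disjoint (ℚ.≤-trans s≥ (ℕ→ℚ-mono-≤ s≤S)) (ℚ.≤-trans t≥ t≤T)
      0<S : 0ℚ < ℕ→ℚ ∣ S ∣
      0<S = ℚ.<-≤-trans (ℚ.positive⁻¹ 1ℚ) (ℕ→ℚ-mono-≤ (ℕ.≤-trans 0<s s≤S))
      strict : ℕ→ℚ ∣ S ∣ * Δ < ℕ→ℚ ∣ S ∣ * ((d - ε) * ℕ→ℚ ∣ T ∣)
      strict = ℚ.*-monoʳ-<-pos (ℕ→ℚ ∣ S ∣) {{positive 0<S}}
        (ℚ.<-≤-trans Δ< (ℚ.*-monoˡ-≤-nonNeg (d - ε) {{nonNegative 0≤d-ε}} t≤T))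
      decide : Dec Hit → ∃₂ λ x y → x ∈ xs × y ∈ ts × adj (G ⊖ H) x y ≡ true
      decide (yes hit) with find hit
      ... | x , x∈ , hit′ with find hit′
      ...   | y , y∈ , xy = x , y , x∈ , y∈ , xy
      decide (no miss) = contradiction
        (ℚ.≤-<-trans lower (ℚ.≤-<-trans (eST-≤ S T maxdeg (none miss)) strict)) (ℚ.<-irrefl refl)

-- Choice of the parameters and the theorem

module _ {n : ℕ} (G H : Graph n) {d e : ℚ} (0≤d : 0ℚ ≤ d) (0≤e : 0ℚ ≤ e) (d≤1 : d ≤ 1ℚ) (e≤1/32 : e ≤ + 1 / 32)
  (8≤den : + 8 / 1 ≤ d * e * ℕ→ℚ n) (regular : Regular d (d * e) G)
  (maxdeg : MaxDegree≤ H ((d * ½ - + 8 / 1 * e) * ℕ→ℚ n)) where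

  0≤n : 0ℚ ≤ ℕ→ℚ n
  0≤n = ℕ→ℚ-mono-≤ {0} {n} z≤n

  open Estimates 0≤d 0≤e 0≤n d≤1 e≤1/32 8≤den

  -- The choices before rounding: `s` is the least size to which regularity applies. A vertex with
  -- `d n / 2` neighbours has on average `2 d e n` of them, twice `s`, in a window of length
  -- `ℓ = 4 e n`. Two such windows leave room for `t` below `(1/2 − 4 e) n`, and `(1/2 − 6 e) n` is
  -- still large enough for expansion.
  regular-resilience : HamiltonCycle (G ⊖ H)
  regular-resilience = from-ceilings
    (ceil (d * e * ℕ→ℚ n) (0≤d ⊗ 0≤e ⊗ 0≤n)) (ceil ((½ - + 6 / 1 * e) * ℕ→ℚ n) (0≤½-6e ⊗ 0≤n))
    (ceil (+ 4 / 1 * e * ℕ→ℚ n) (0≤const (+ 4 / 1) ⊗ 0≤e ⊗ 0≤n)) (ceil (d * ½ * ℕ→ℚ n) (0≤d ⊗ 0≤const ½ ⊗ 0≤n))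
    where
    from-ceilings : Ceiling (d * e * ℕ→ℚ n) → Ceiling ((½ - + 6 / 1 * e) * ℕ→ℚ n) →
      Ceiling (+ 4 / 1 * e * ℕ→ℚ n) → Ceiling (d * ½ * ℕ→ℚ n) → HamiltonCycle (G ⊖ H)
    from-ceilings (s , s≥ , s≤) (t , t≥ , t≤) (ℓ , ℓ≥ , ℓ≤) (c , c≥ , c≤) =
      hamilton-cycle (G ⊖ H) {s} {t} {ℓ} {c}
        (regular⇒expands G H {d} {d * e} regular maxdeg 0≤d-de 0<s s≥ (size-bound t≥) (expansion-bound t≥))
        0<ℓ min-degree dense room
      where
      0<s : 0 ℕ.< s
      0<s = ℕ→ℚ-cancel-≤ {1} {s} (ℚ.≤-trans (ℚ.≤-trans (by-gap (0≤const (+ 7 / 1)) refl) 8≤den) s≥)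
      0<ℓ : 0 ℕ.< ℓ
      0<ℓ = ℕ→ℚ-cancel-≤ {1} {ℓ} (ℚ.≤-trans (1≤4en) ℓ≥)
      open ℚ.≤-Reasoning
      min-degree : ∀ v → c ℕ.+ ℓ ℕ.≤ degree (G ⊖ H) v
      min-degree v = ℕ→ℚ-cancel-≤ (begin
        ℕ→ℚ (c ℕ.+ ℓ)                         ≡⟨ ℕ→ℚ-+ c ℓ ⟩
        ℕ→ℚ c + ℕ→ℚ ℓ                         ≤⟨ degree-bound c≤ ℓ≤ ⟩
        (d * ½ + + 8 / 1 * e) * ℕ→ℚ n         ≤⟨ residual-degree-bound (proj₁ regular v) (maxdeg v) deg-sum ⟩
        ℕ→ℚ (degree (G ⊖ H) v)                ∎)
        where
        deg-sum : ℕ→ℚ (degree G v) ≤ ℕ→ℚ (degree (G ⊖ H) v) + ℕ→ℚ (degree H v)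
        deg-sum = ℚ.≤-trans (ℕ→ℚ-mono-≤ (degree-⊖ G H v)) (ℚ.≤-reflexive (ℕ→ℚ-+ (degree (G ⊖ H) v) (degree H v)))
      dense : suc s ℕ.* (n ℕ.+ (ℓ ℕ.+ ℓ)) ℕ.≤ c ℕ.* ℓ
      dense = ℕ→ℚ-cancel-≤ (begin
        ℕ→ℚ (suc s ℕ.* (n ℕ.+ (ℓ ℕ.+ ℓ)))               ≡⟨ ℕ→ℚ-* (suc s) (n ℕ.+ (ℓ ℕ.+ ℓ)) ⟩
        ℕ→ℚ (suc s) * ℕ→ℚ (n ℕ.+ (ℓ ℕ.+ ℓ))             ≡⟨ cong₂ _*_ (ℕ→ℚ-+ 1 s) (≡.trans (ℕ→ℚ-+ n (ℓ ℕ.+ ℓ)) (cong (λ z → ℕ→ℚ n + z) (ℕ→ℚ-+ ℓ ℓ))) ⟩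
        (1ℚ + ℕ→ℚ s) * (ℕ→ℚ n + (ℕ→ℚ ℓ + ℕ→ℚ ℓ))        ≤⟨ density-bound (ℕ→ℚ-mono-≤ {0} {ℓ} z≤n) (ℕ→ℚ-mono-≤ {0} {s} z≤n) c≥ ℓ≥ ℓ≤ s≤ ⟩
        ℕ→ℚ c * ℕ→ℚ ℓ                                   ≡⟨ ℕ→ℚ-* c ℓ ⟨
        ℕ→ℚ (c ℕ.* ℓ)                                   ∎)
      room : t ℕ.+ t ℕ.+ 3 ℕ.+ (ℓ ℕ.+ ℓ) ℕ.≤ n
      room = ℕ→ℚ-cancel-≤ (begin
        ℕ→ℚ (t ℕ.+ t ℕ.+ 3 ℕ.+ (ℓ ℕ.+ ℓ))                   ≡⟨ ℕ→ℚ-+ (t ℕ.+ t ℕ.+ 3) (ℓ ℕ.+ ℓ) ⟩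
        ℕ→ℚ (t ℕ.+ t ℕ.+ 3) + ℕ→ℚ (ℓ ℕ.+ ℓ)                 ≡⟨ cong₂ _+_ (≡.trans (ℕ→ℚ-+ (t ℕ.+ t) 3) (cong (λ z → z + + 3 / 1) (ℕ→ℚ-+ t t))) (ℕ→ℚ-+ ℓ ℓ) ⟩
        ℕ→ℚ t + ℕ→ℚ t + + 3 / 1 + (ℕ→ℚ ℓ + ℕ→ℚ ℓ)           ≤⟨ room-bound t≤ ℓ≤ ⟩
        ℕ→ℚ n                                               ∎)

threshold : ∀ ε → 0ℚ < ε → ∃ λ N → ∀ n → n ≥ N → + 8 / 1 ≤ ε * ℕ→ℚ n
threshold ε 0<ε = proj₁ bound , λ n n≥N → begin
  + 8 / 1                         ≡⟨ ℚ.*-identityˡ (+ 8 / 1) ⟨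
  1ℚ * (+ 8 / 1)                  ≡⟨ cong (_* (+ 8 / 1)) (ℚ.*-inverseʳ ε) ⟨
  ε * (ℚ.1/ ε) * (+ 8 / 1)        ≡⟨ ℚ.*-assoc ε (ℚ.1/ ε) (+ 8 / 1) ⟩
  ε * ((ℚ.1/ ε) * (+ 8 / 1))      ≤⟨ ℚ.*-monoˡ-≤-nonNeg ε {{ℚ.pos⇒nonNeg ε}} (ℚ.≤-trans (proj₂ bound) (ℕ→ℚ-mono-≤ n≥N)) ⟩
  ε * ℕ→ℚ n                       ∎
  where
  open ℚ.≤-Reasoning
  instance
    _ = positive 0<ε
    _ = ℚ.pos⇒nonZero ε
  bound = archimedean ((ℚ.1/ ε) * (+ 8 / 1))

theorem4p1 : (d : ℚ) (d>0 : d > 0ℚ) → d ≤ 1ℚ →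
    Σ ℚ λ ε₀ → ε₀ > 0ℚ × ((ε : ℚ) → ε > 0ℚ → ε < ε₀ →
    Σ ℕ λ N → (n : ℕ) → n ≥ N → (G : Graph n) → Regular d ε G →
    (H : Graph n) → H ⊑ G →
    MaxDegree≤ H ((d * (+ 1 / 2) - c d d>0 * ε) * ℕ→ℚ n) →
    HamiltonCycle (G ⊖ H))
-- With `e = ε / d` the bound `ε < d / 32` becomes `e < 1/32`, and `c d d>0 * ε` becomes `8 e`; the
-- hypotheses are rewritten along `ε = d e`.
theorem4p1 d d>0 d≤1 = d * (+ 1 / 32) , ℚ.positive⁻¹ (d * (+ 1 / 32)) {{ℚ.pos*pos⇒pos d (+ 1 / 32)}} ,
  λ ε ε>0 ε<ε₀ → proj₁ (threshold ε ε>0) , λ n n≥N G regular H _ maxdeg →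
    regular-resilience G H (ℚ.<⇒≤ d>0) (0≤e ε ε>0) d≤1 (e≤1/32 ε ε<ε₀)
      (subst (λ z → + 8 / 1 ≤ z * ℕ→ℚ n) (ε≡de ε) (proj₂ (threshold ε ε>0) n n≥N))
      (subst (λ z → Regular d z G) (ε≡de ε) regular)
      (subst (λ z → MaxDegree≤ H ((d * ½ - z) * ℕ→ℚ n)) (ℚ.*-assoc (+ 8 / 1) (ℚ.1/ d) ε) maxdeg)
  where
  instance
    _ = positive d>0
    _ = ℚ.pos⇒nonZero d
  ε≡de : ∀ ε → ε ≡ d * ((ℚ.1/ d) * ε)
  ε≡de ε = ≡.trans (≡.sym (ℚ.*-identityˡ ε)) (≡.trans (cong (_* ε) (≡.sym (ℚ.*-inverseʳ d))) (ℚ.*-assoc d (ℚ.1/ d) ε))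
  0≤e : ∀ ε → 0ℚ < ε → 0ℚ ≤ (ℚ.1/ d) * ε
  0≤e ε ε>0 = ℚ.<⇒≤ (ℚ.positive⁻¹ _ {{ℚ.pos*pos⇒pos (ℚ.1/ d) {{ℚ.1/pos⇒pos d}} ε {{positive ε>0}}}})
  e≤1/32 : ∀ ε → ε < d * (+ 1 / 32) → (ℚ.1/ d) * ε ≤ + 1 / 32
  e≤1/32 ε ε<ε₀ = ℚ.*-cancelˡ-≤-pos d (ℚ.≤-trans (ℚ.≤-reflexive (≡.sym (ε≡de ε))) (ℚ.<⇒≤ ε<ε₀))
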